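{- Let $a,b$ be non-zero real numbers, let $(J_n)_{n\ge 0}$ be the bi-periodic Jacobsthal matrix sequence associated with $a,b$, and let $$\alpha=\frac{ab+\sqrt{a^2b^2+8ab}}{2},\qquad \beta=\frac{ab-\sqrt{a^2b^2+8ab}}{2}$$ be the roots of $x^2-abx-2ab=0$. Then for every natural number $n$, $$J_n=A\left(\alpha^n-\beta^n\right)+B\left(\alpha^{2\lfloor n/2\rfloor+2}-\beta^{2\lfloor n/2\rfloor+2}\right),$$ where the matrices $A$ and $B$ (depending on $n$) are $$A=\frac{\left(J_1-bJ_0\right)^{\varepsilon(n)}\left(aJ_1-2J_0-abJ_0\right)^{1-\varepsilon(n)}}{(ab)^{\lfloor n/2\rfloor}(\alpha-\beta)},\qquad B=\frac{b^{\varepsilon(n)}J_0}{(ab)^{\lfloor n/2\rfloor+1}(\alpha-\beta)};$$ in component form, $$A=\frac{1}{(ab)^{\lfloor n/2\rfloor}(\alpha-\beta)}\begin{pmatrix}0&2\frac{b}{a}\\ 1&-b\end{pmatrix}^{\varepsilon(n)}\begin{pmatrix}-2&2b\\ a&-2-ab\end{pmatrix}^{1-\varepsilon(n)},\qquad B=\frac{b^{\varepsilon(n)}}{(ab)^{\lfloor n/2\rfloor+1}(\alpha-\beta)}\begin{pmatrix}1&0\\0&1\end{pmatrix}.$$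
   Context: Fix non-zero real numbers $a,b$. The parity function is $\varepsilon(n)=0$ if $n$ is even and $\varepsilon(n)=1$ if $n$ is odd. The zeroth power of a matrix is the identity matrix. The bi-periodic Jacobsthal matrix sequence $(J_n)_{n\ge 0}$ of $2\times 2$ real matrices is defined by $J_0=\begin{pmatrix}1&0\\0&1\end{pmatrix}$, $J_1=\begin{pmatrix} b & 2\frac{b}{a}\\ 1&0\end{pmatrix}$, and for $n\ge 2$: $J_n=aJ_{n-1}+2J_{n-2}$ if $n$ is even, $J_n=bJ_{n-1}+2J_{n-2}$ if $n$ is odd.
   Formalization: The theorem additionally assumes α ≠ β (equivalently ab ≠ −8): when ab = −8, e.g. a = 1, b = −8, α − β = 0 and the matrices A and B, which divide by α − β, are undefined. -}

module Defs where

open import Level using (0ℓ; _⊔_)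
open import Data.Bool.Base using (if_then_else_)
import Data.Fin.Properties as Fin
open import Data.Integer.Base using (+_)
open import Data.Nat.Base as ℕ using (ℕ; zero; suc; ⌊_/2⌋; _∸_; _≡ᵇ_; _%_)
import Data.Nat.Properties as ℕ
open import Data.Product.Base using (∃-syntax; _×_; _,_; proj₁; proj₂)
open import Data.Rational.Base as ℚ using (ℚ; 0ℚ; 1ℚ; ½)
import Data.Rational.Properties as ℚ
open import Data.Rational.Solver using (module +-*-Solver)
open import Data.Sum.Base using (_⊎_; inj₁; inj₂)
import Data.Sum.Base as Sum
open import Data.Vec.Functional using (Vector; []; _∷_)
open import Function.Base using (_∘_; _$_)
open import Relation.Nullary.Decidable using (Dec; yes; no; does)
open import Relation.Nullary.Negation using (¬_; contradiction)
open import Relation.Binary.Definitions using (Tight; Cotransitive)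
open import Relation.Binary.PropositionalEquality as ≡ using (_≡_; _≢_)
open import Relation.Binary.Structures using (IsEquivalence; IsApartnessRelation)
open import Algebra.Bundles using (CommutativeRing; RawSemiring)
open import Algebra.Definitions using (Invertible)
open import Algebra.Structures using (IsCommutativeRing)
open import Algebra.Apartness.Bundles using (HeytingField)
open import Algebra.Apartness.Structures using (IsHeytingCommutativeRing; IsHeytingField)
import Algebra.Apartness.Properties.HeytingCommutativeRing as HeytingProperties
import Algebra.Definitions.RawSemiring as RawSemiringDefinitions
import Algebra.Properties.Ring as RingProperties
import Algebra.Solver.Ring.NaturalCoefficients.Default as SemiringSolver

module RationalEstimates where
  open import Data.Rational.Base hiding (_⊔_)
  open ℚ.≤-Reasoning
  open +-*-Solver

  private variable
    p q r p′ q′ δ ε B : ℚ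

  0<* : 0ℚ < p → 0ℚ < q → 0ℚ < p * q
  0<* {p} {q} 0<p 0<q =
    ℚ.positive⁻¹ (p * q) {{ℚ.pos*pos⇒pos p {{positive 0<p}} q {{positive 0<q}}}}

  0<½* : 0ℚ < ε → 0ℚ < ½ * ε
  0<½* = 0<* (ℚ.positive⁻¹ ½)

  ½*-+-½* : ∀ ε → ½ * ε + ½ * ε ≡ ε
  ½*-+-½* = solve 1 (λ ε → con ½ :* ε :+ con ½ :* ε := ε) ≡.refl

  ½*-<-self : 0ℚ < ε → ½ * ε < ε
  ½*-<-self {ε} 0<ε = begin-strict
    ½ * ε           ≡⟨ ℚ.+-identityʳ (½ * ε) ⟨
    ½ * ε + 0ℚ      <⟨ ℚ.+-monoʳ-< (½ * ε) (0<½* 0<ε) ⟩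
    ½ * ε + ½ * ε   ≡⟨ ½*-+-½* ε ⟩
    ε               ∎

  ∣p-q∣≡∣q-p∣ : ∀ p q → ∣ p - q ∣ ≡ ∣ q - p ∣
  ∣p-q∣≡∣q-p∣ p q = begin-equality
    ∣ p - q ∣       ≡⟨ ≡.cong ∣_∣ (solve 2 (λ p q → p :- q := :- (q :- p)) ≡.refl p q) ⟩
    ∣ - (q - p) ∣   ≡⟨ ℚ.∣-p∣≡∣p∣ (q - p) ⟩
    ∣ q - p ∣       ∎

  ∣p∣≤∣q∣+∣p-q∣ : ∀ p q → ∣ p ∣ ≤ ∣ q ∣ + ∣ p - q ∣
  ∣p∣≤∣q∣+∣p-q∣ p q = begin
    ∣ p ∣               ≡⟨ ≡.cong ∣_∣ (solve 2 (λ p q → p := q :+ (p :- q)) ≡.refl p q) ⟩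
    ∣ q + (p - q) ∣     ≤⟨ ℚ.∣p+q∣≤∣p∣+∣q∣ q (p - q) ⟩
    ∣ q ∣ + ∣ p - q ∣   ∎

  +-halves : p < ½ * ε → q < ½ * ε → p + q < ε
  +-halves {p} {ε} {q} p<½ε q<½ε = begin-strict
    p + q           <⟨ ℚ.+-mono-< p<½ε q<½ε ⟩
    ½ * ε + ½ * ε   ≡⟨ ½*-+-½* ε ⟩
    ε               ∎

  +-close : ∣ p - p′ ∣ < ½ * ε → ∣ q - q′ ∣ < ½ * ε → ∣ (p + q) - (p′ + q′) ∣ < ε
  +-close {p} {p′} {ε} {q} {q′} p≈p′ q≈q′ = begin-strict
    ∣ (p + q) - (p′ + q′) ∣
      ≡⟨ ≡.cong ∣_∣ (solve 4 (λ p p′ q q′ →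
           (p :+ q) :- (p′ :+ q′) := (p :- p′) :+ (q :- q′)) ≡.refl p p′ q q′) ⟩
    ∣ (p - p′) + (q - q′) ∣   ≤⟨ ℚ.∣p+q∣≤∣p∣+∣q∣ (p - p′) (q - q′) ⟩
    ∣ p - p′ ∣ + ∣ q - q′ ∣   <⟨ +-halves p≈p′ q≈q′ ⟩
    ε                         ∎

  ∣p-r∣<ε : ∣ p - q ∣ < ½ * ε → ∣ q - r ∣ < ½ * ε → ∣ p - r ∣ < ε
  ∣p-r∣<ε {p} {q} {ε} {r} p≈q q≈r = begin-strict
    ∣ p - r ∣
      ≡⟨ ≡.cong ∣_∣ (solve 3 (λ p q r → p :- r := (p :- q) :+ (q :- r)) ≡.refl p q r) ⟩
    ∣ (p - q) + (q - r) ∣     ≤⟨ ℚ.∣p+q∣≤∣p∣+∣q∣ (p - q) (q - r) ⟩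
    ∣ p - q ∣ + ∣ q - r ∣     <⟨ +-halves p≈q q≈r ⟩
    ε                         ∎

  -‿close : ∣ p - q ∣ < ε → ∣ - p - - q ∣ < ε
  -‿close {p} {q} {ε} p≈q = begin-strict
    ∣ - p - - q ∣   ≡⟨ ≡.cong ∣_∣ (solve 2 (λ p q → :- p :- :- q := q :- p) ≡.refl p q) ⟩
    ∣ q - p ∣       ≡⟨ ∣p-q∣≡∣q-p∣ q p ⟩
    ∣ p - q ∣       <⟨ p≈q ⟩
    ε               ∎

  ∣*∣<* : 0ℚ < B → ∣ p ∣ ≤ B → ∣ q ∣ < δ → ∣ p * q ∣ < B * δ
  ∣*∣<* {B} {p} {q} {δ} 0<B ∣p∣≤B ∣q∣<δ = begin-strict
    ∣ p * q ∣       ≡⟨ ℚ.∣p*q∣≡∣p∣*∣q∣ p q ⟩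
    ∣ p ∣ * ∣ q ∣   ≤⟨ ℚ.*-monoʳ-≤-nonNeg ∣ q ∣ {{ℚ.∣-∣-nonNeg q}} ∣p∣≤B ⟩
    B * ∣ q ∣       <⟨ ℚ.*-monoʳ-<-pos B {{ℚ.positive 0<B}} ∣q∣<δ ⟩
    B * δ           ∎

  *-close : 0ℚ < B → B * δ ≡ ½ * ε → ∣ p ∣ ≤ B → ∣ q′ ∣ ≤ B →
            ∣ p - p′ ∣ < δ → ∣ q - q′ ∣ < δ → ∣ p * q - p′ * q′ ∣ < ε
  *-close {B} {δ} {ε} {p} {q′} {p′} {q} 0<B Bδ≡½ε ∣p∣≤B ∣q′∣≤B p≈p′ q≈q′ = begin-strict
    ∣ p * q - p′ * q′ ∣
      ≡⟨ ≡.cong ∣_∣ (solve 4 (λ p p′ q q′ →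
           p :* q :- p′ :* q′ := p :* (q :- q′) :+ q′ :* (p :- p′)) ≡.refl p p′ q q′) ⟩
    ∣ p * (q - q′) + q′ * (p - p′) ∣
      ≤⟨ ℚ.∣p+q∣≤∣p∣+∣q∣ (p * (q - q′)) (q′ * (p - p′)) ⟩
    ∣ p * (q - q′) ∣ + ∣ q′ * (p - p′) ∣
      <⟨ ℚ.+-mono-< (∣*∣<* 0<B ∣p∣≤B q≈q′) (∣*∣<* 0<B ∣q′∣≤B p≈p′) ⟩
    B * δ + B * δ     ≡⟨ ≡.cong₂ _+_ Bδ≡½ε Bδ≡½ε ⟩
    ½ * ε + ½ * ε     ≡⟨ ½*-+-½* ε ⟩
    ε                 ∎

  divide : 0ℚ < B → 0ℚ < ε → ∃[ δ ] 0ℚ < δ × B * δ ≡ ε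
  divide {B} {ε} 0<B 0<ε = ε * 1/B , 0<* 0<ε 0<1/B , (begin-equality
    B * (ε * 1/B)   ≡⟨ solve 3 (λ B ε i → B :* (ε :* i) := ε :* (B :* i)) ≡.refl B ε 1/B ⟩
    ε * (B * 1/B)   ≡⟨ ≡.cong (ε *_) (ℚ.*-inverseʳ B) ⟩
    ε * 1ℚ          ≡⟨ ℚ.*-identityʳ ε ⟩
    ε               ∎)
    where
    instance
      _ = ℚ.positive 0<B
      _ = ℚ.pos⇒nonZero B
    1/B = 1/ B
    0<1/B : 0ℚ < 1/B
    0<1/B = ℚ.positive⁻¹ 1/B {{ℚ.1/pos⇒pos B}}

  ≤∣∣⇒≢0 : 0ℚ < ε → ε ≤ ∣ p ∣ → p ≢ 0ℚ
  ≤∣∣⇒≢0 0<ε ε≤∣p∣ ≡.refl = ℚ.<-irrefl ≡.refl (ℚ.<-≤-trans 0<ε ε≤∣p∣)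

  ∣p∣-lower : ε ≤ ∣ q ∣ → ∣ p - q ∣ < ½ * ε → ½ * ε ≤ ∣ p ∣
  ∣p∣-lower {ε} {q} {p} ε≤∣q∣ p≈q = ℚ.≮⇒≥ λ ∣p∣<½ε → ℚ.<-irrefl ≡.refl $ begin-strict
    ε                   ≤⟨ ε≤∣q∣ ⟩
    ∣ q ∣               ≤⟨ ∣p∣≤∣q∣+∣p-q∣ q p ⟩
    ∣ p ∣ + ∣ q - p ∣   <⟨ +-halves ∣p∣<½ε (≡.subst (_< ½ * ε) (∣p-q∣≡∣q-p∣ p q) p≈q) ⟩
    ε                   ∎

  -- The value at 0 is irrelevant to the reciprocal of a real number apart from 0.
  recip : ℚ → ℚ
  recip p with p ℚ.≟ 0ℚ
  ... | yes _   = 0ℚ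
  ... | no  p≢0 = (1/ p) {{ℚ.≢-nonZero p≢0}}

  recip-inverseˡ : p ≢ 0ℚ → recip p * p ≡ 1ℚ
  recip-inverseˡ {p} p≢0 with p ℚ.≟ 0ℚ
  ... | yes p≡0 = contradiction p≡0 p≢0
  ... | no  p≢0 = ℚ.*-inverseˡ p {{ℚ.≢-nonZero p≢0}}

  recip-close : 0ℚ < ε → ε ≤ ∣ p ∣ → ε ≤ ∣ q ∣ → ∣ p - q ∣ < (ε * ε) * δ → ∣ recip p - recip q ∣ < δ
  recip-close {ε} {p} {q} {δ} 0<ε ε≤∣p∣ ε≤∣q∣ p≈q =
    ℚ.*-cancelˡ-<-nonNeg (ε * ε) {{ℚ.pos⇒nonNeg (ε * ε) {{ε²>0}}}} $ begin-strict
      (ε * ε) * ∣ d ∣           ≤⟨ ℚ.*-monoʳ-≤-nonNeg ∣ d ∣ {{ℚ.∣-∣-nonNeg d}} ε²≤ ⟩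
      (∣ p ∣ * ∣ q ∣) * ∣ d ∣   ≡⟨ ≡.cong (_* ∣ d ∣) (ℚ.∣p*q∣≡∣p∣*∣q∣ p q) ⟨
      ∣ p * q ∣ * ∣ d ∣         ≡⟨ ℚ.∣p*q∣≡∣p∣*∣q∣ (p * q) d ⟨
      ∣ (p * q) * d ∣           ≡⟨ ≡.cong ∣_∣ pqd≡q-p ⟩
      ∣ q - p ∣                 ≡⟨ ∣p-q∣≡∣q-p∣ q p ⟩
      ∣ p - q ∣                 <⟨ p≈q ⟩
      (ε * ε) * δ               ∎
    where
    d = recip p - recip q
    ε²>0 = ℚ.positive (0<* 0<ε 0<ε)
    ε²≤ : ε * ε ≤ ∣ p ∣ * ∣ q ∣
    ε²≤ = begin
      ε * ε           ≤⟨ ℚ.*-monoʳ-≤-nonNeg ε {{ℚ.pos⇒nonNeg ε {{ℚ.positive 0<ε}}}} ε≤∣p∣ ⟩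
      ∣ p ∣ * ε       ≤⟨ ℚ.*-monoˡ-≤-nonNeg ∣ p ∣ {{ℚ.∣-∣-nonNeg p}} ε≤∣q∣ ⟩
      ∣ p ∣ * ∣ q ∣   ∎
    pqd≡q-p : (p * q) * d ≡ q - p
    pqd≡q-p = begin-equality
      (p * q) * (recip p - recip q)
        ≡⟨ solve 4 (λ p q i j → (p :* q) :* (i :- j) := (i :* p) :* q :- (j :* q) :* p)
             ≡.refl p q (recip p) (recip q) ⟩
      (recip p * p) * q - (recip q * q) * p
        ≡⟨ ≡.cong₂ (λ i j → i * q - j * p) (recip-inverseˡ (≤∣∣⇒≢0 0<ε ε≤∣p∣))
                                           (recip-inverseˡ (≤∣∣⇒≢0 0<ε ε≤∣q∣)) ⟩
      1ℚ * q - 1ℚ * p   ≡⟨ ≡.cong₂ _-_ (ℚ.*-identityˡ q) (ℚ.*-identityˡ p) ⟩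
      q - p             ∎

-- A real number is a Cauchy sequence of rationals; equality of reals is the
-- relation Real._≈_, and "different" is the apartness Real._#_, which is what
-- division requires (classically it is the negation of _≈_).

record IsCauchy (f : ℕ → ℚ) : Set where
  constructor mkCauchy
  field
    eventually-close : ∀ {ε} → 0ℚ ℚ.< ε →
      ∃[ N ] ∀ {m n} → N ℕ.≤ m → N ℕ.≤ n → ℚ.∣ f m ℚ.- f n ∣ ℚ.< ε

record ℝ : Set where
  constructor mkℝ
  field
    seq      : ℕ → ℚ
    isCauchy : IsCauchy seq

module Real where
  open RationalEstimates
  open ℝ

  infix  8 -_
  infixl 7 _*_
  infixl 6 _+_
  infix  4 _≈_ _#_

  record _≈_ (x y : ℝ) : Set where
    constructor mk≈
    field
      eventually-close : ∀ {ε} → 0ℚ ℚ.< ε →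
        ∃[ N ] ∀ {n} → N ℕ.≤ n → ℚ.∣ seq x n ℚ.- seq y n ∣ ℚ.< ε

  open _≈_

  record _#_ (x y : ℝ) : Set where
    constructor mk#
    field
      gap              : ℚ
      0<gap            : 0ℚ ℚ.< gap
      eventually-apart : ∃[ N ] ∀ {n} → N ℕ.≤ n → gap ℚ.≤ ℚ.∣ seq x n ℚ.- seq y n ∣

  private variable
    f g   : ℕ → ℚ
    x y z : ℝ

  private
    both : {P Q R : ℕ → Set} → (∀ {n} → P n → Q n → R n) →
           (∃[ N ] ∀ {n} → N ℕ.≤ n → P n) → (∃[ N ] ∀ {n} → N ℕ.≤ n → Q n) →
           (∃[ N ] ∀ {n} → N ℕ.≤ n → R n)
    both h (M , p) (N , q) = M ℕ.⊔ N , λ M⊔N≤n →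
      h (p (ℕ.m⊔n≤o⇒m≤o M N M⊔N≤n)) (q (ℕ.m⊔n≤o⇒n≤o M N M⊔N≤n))

    both₂ : {P Q R : ℕ → ℕ → Set} → (∀ {m n} → P m n → Q m n → R m n) →
            (∃[ N ] ∀ {m n} → N ℕ.≤ m → N ℕ.≤ n → P m n) →
            (∃[ N ] ∀ {m n} → N ℕ.≤ m → N ℕ.≤ n → Q m n) →
            (∃[ N ] ∀ {m n} → N ℕ.≤ m → N ℕ.≤ n → R m n)
    both₂ h (M , p) (N , q) = M ℕ.⊔ N , λ ≤m ≤n →
      h (p (ℕ.m⊔n≤o⇒m≤o M N ≤m) (ℕ.m⊔n≤o⇒m≤o M N ≤n))
        (q (ℕ.m⊔n≤o⇒n≤o M N ≤m) (ℕ.m⊔n≤o⇒n≤o M N ≤n))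

  abstract
    eventually-bounded : IsCauchy f →
      ∃[ B ] 0ℚ ℚ.< B × (∃[ N ] ∀ {n} → N ℕ.≤ n → ℚ.∣ f n ∣ ℚ.≤ B)
    eventually-bounded {f} (mkCauchy f-cauchy) with f-cauchy (ℚ.positive⁻¹ 1ℚ)
    ... | N , close = ℚ.∣ f N ∣ ℚ.+ 1ℚ , 0<B , N , λ {n} N≤n →
      ℚ.≤-trans (∣p∣≤∣q∣+∣p-q∣ (f n) (f N))
                (ℚ.+-monoʳ-≤ ℚ.∣ f N ∣ (ℚ.<⇒≤ (close N≤n ℕ.≤-refl)))
      where
      0<B : 0ℚ ℚ.< ℚ.∣ f N ∣ ℚ.+ 1ℚ
      0<B = ℚ.+-mono-≤-< (ℚ.0≤∣p∣ (f N)) (ℚ.positive⁻¹ 1ℚ)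

    common-bound : IsCauchy f → IsCauchy g →
      ∃[ B ] 0ℚ ℚ.< B × (∃[ N ] ∀ {n} → N ℕ.≤ n → ℚ.∣ f n ∣ ℚ.≤ B × ℚ.∣ g n ∣ ℚ.≤ B)
    common-bound {f} {g} cf cg =
      let B , 0<B , f≤B = eventually-bounded cf
          C , 0<C , g≤C = eventually-bounded cg
      in B ℚ.+ C , 0<+ B C 0<B 0<C , both (λ {n} → enlarge B C 0<B 0<C (f n) (g n)) f≤B g≤C
      where
      0<+ : ∀ B C → 0ℚ ℚ.< B → 0ℚ ℚ.< C → 0ℚ ℚ.< B ℚ.+ C
      0<+ B C 0<B 0<C = ℚ.+-mono-< {0ℚ} {B} {0ℚ} {C} 0<B 0<C
      enlarge : ∀ B C → 0ℚ ℚ.< B → 0ℚ ℚ.< C → ∀ p q → ℚ.∣ p ∣ ℚ.≤ B → ℚ.∣ q ∣ ℚ.≤ C →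
                ℚ.∣ p ∣ ℚ.≤ B ℚ.+ C × ℚ.∣ q ∣ ℚ.≤ B ℚ.+ C
      enlarge B C 0<B 0<C p q p≤B q≤C =
          ≡.subst (ℚ._≤ B ℚ.+ C) (ℚ.+-identityʳ ℚ.∣ p ∣) (ℚ.+-mono-≤ p≤B (ℚ.<⇒≤ 0<C))
        , ≡.subst (ℚ._≤ B ℚ.+ C) (ℚ.+-identityˡ ℚ.∣ q ∣) (ℚ.+-mono-≤ (ℚ.<⇒≤ 0<B) q≤C)

    const-isCauchy : ∀ q → IsCauchy (λ _ → q)
    const-isCauchy q = mkCauchy λ 0<ε → 0 , λ _ _ →
      ≡.subst (ℚ._< _) (≡.sym (≡.cong ℚ.∣_∣ (ℚ.+-inverseʳ q))) 0<ε

    +-isCauchy : IsCauchy f → IsCauchy g → IsCauchy (λ n → f n ℚ.+ g n)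
    +-isCauchy {f} {g} (mkCauchy f-cauchy) (mkCauchy g-cauchy) = mkCauchy λ 0<ε →
      both₂ (λ {m} {n} → +-close {f m} {f n} {_} {g m} {g n})
            (f-cauchy (0<½* 0<ε)) (g-cauchy (0<½* 0<ε))

    -‿isCauchy : IsCauchy f → IsCauchy (λ n → ℚ.- f n)
    -‿isCauchy {f} (mkCauchy f-cauchy) = mkCauchy λ 0<ε → let N , close = f-cauchy 0<ε in
      N , λ {m} {n} ≤m ≤n → -‿close {f m} {f n} (close ≤m ≤n)

    *-isCauchy : IsCauchy f → IsCauchy g → IsCauchy (λ n → f n ℚ.* g n)
    *-isCauchy {f} {g} cf@(mkCauchy f-cauchy) cg@(mkCauchy g-cauchy) = mkCauchy λ 0<ε →
      let B , 0<B , N , bound = common-bound cf cg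
          δ , 0<δ , Bδ≡½ε     = divide 0<B (0<½* 0<ε)
      in both₂ (λ {m} {n} (f≤B , g≤B) (f≈ , g≈) →
                  *-close {B} {δ} {_} {f m} {g n} {f n} {g m} 0<B Bδ≡½ε f≤B g≤B f≈ g≈)
           (N , λ ≤m ≤n → proj₁ (bound ≤m) , proj₂ (bound ≤n))
           (both₂ _,_ (f-cauchy 0<δ) (g-cauchy 0<δ))

    recip-isCauchy : ∀ {η} → 0ℚ ℚ.< η → (∃[ N ] ∀ {n} → N ℕ.≤ n → η ℚ.≤ ℚ.∣ f n ∣) →
                     IsCauchy f → IsCauchy (λ n → recip (f n))
    recip-isCauchy {f} 0<η (N , apart) (mkCauchy f-cauchy) = mkCauchy λ 0<ε →
      both₂ (λ {m} {n} (≤m , ≤n) → recip-close {p = f m} {f n} 0<η ≤m ≤n)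
        (N , λ ≤m ≤n → apart ≤m , apart ≤n) (f-cauchy (0<* (0<* 0<η 0<η) 0<ε))

  fromℚ : ℚ → ℝ
  fromℚ q = mkℝ (λ _ → q) (const-isCauchy q)

  0# 1# : ℝ
  0# = fromℚ 0ℚ
  1# = fromℚ 1ℚ

  _+_ _*_ : ℝ → ℝ → ℝ
  x + y = mkℝ (λ n → seq x n ℚ.+ seq y n) (+-isCauchy (isCauchy x) (isCauchy y))
  x * y = mkℝ (λ n → seq x n ℚ.* seq y n) (*-isCauchy (isCauchy x) (isCauchy y))

  -_ : ℝ → ℝ
  - x = mkℝ (λ n → ℚ.- seq x n) (-‿isCauchy (isCauchy x))

  _-_ : ℝ → ℝ → ℝ
  x - y = x + - y

  abstract
    pointwise⇒≈ : (∀ n → seq x n ≡ seq y n) → x ≈ y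
    pointwise⇒≈ {x} {y} eq = mk≈ λ 0<ε → 0 , λ {n} _ →
      ≡.subst (ℚ._< _) (≡.cong ℚ.∣_∣ (≡.sym (≡.trans (≡.cong (ℚ._- seq y n) (eq n))
                                                    (ℚ.+-inverseʳ (seq y n))))) 0<ε

    ≈-sym : x ≈ y → y ≈ x
    ≈-sym {x} {y} (mk≈ x≈y) = mk≈ λ 0<ε → let N , close = x≈y 0<ε in
      N , λ {n} N≤n → ≡.subst (ℚ._< _) (∣p-q∣≡∣q-p∣ (seq x n) (seq y n)) (close N≤n)

    ≈-trans : x ≈ y → y ≈ z → x ≈ z
    ≈-trans {x} {y} {z} (mk≈ x≈y) (mk≈ y≈z) = mk≈ λ 0<ε →
      both (λ {n} → ∣p-r∣<ε {seq x n} {seq y n} {_} {seq z n}) (x≈y (0<½* 0<ε)) (y≈z (0<½* 0<ε))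

    +-cong : ∀ {x y u v} → x ≈ y → u ≈ v → x + u ≈ y + v
    +-cong {x} {y} {u} {v} (mk≈ x≈y) (mk≈ u≈v) = mk≈ λ 0<ε →
      both (λ {n} → +-close {seq x n} {seq y n} {_} {seq u n} {seq v n})
        (x≈y (0<½* 0<ε)) (u≈v (0<½* 0<ε))

    -‿cong : x ≈ y → - x ≈ - y
    -‿cong {x} {y} (mk≈ x≈y) = mk≈ λ 0<ε → let N , close = x≈y 0<ε in
      N , λ {n} N≤n → -‿close {seq x n} {seq y n} (close N≤n)

    *-cong : ∀ {x y u v} → x ≈ y → u ≈ v → x * u ≈ y * v
    *-cong {x} {y} {u} {v} (mk≈ x≈y) (mk≈ u≈v) = mk≈ λ 0<ε →
      let B , 0<B , bound   = common-bound (isCauchy x) (isCauchy v)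
          δ , 0<δ , Bδ≡½ε = divide 0<B (0<½* 0<ε)
      in both (λ {n} (x≤B , v≤B) (x≈ , u≈) →
                 *-close {B} {δ} {_} {seq x n} {seq v n} {seq y n} {seq u n}
                   0<B Bδ≡½ε x≤B v≤B x≈ u≈)
           bound (both _,_ (x≈y 0<δ) (u≈v 0<δ))

    ≈-isEquivalence : IsEquivalence _≈_
    ≈-isEquivalence = record
      { refl  = pointwise⇒≈ λ _ → ≡.refl
      ; sym   = ≈-sym
      ; trans = ≈-trans
      }

    isCommutativeRing : IsCommutativeRing _≈_ _+_ _*_ -_ 0# 1#
    isCommutativeRing = record
      { isRing = record
        { +-isAbelianGroup = record
          { isGroup = record
            { isMonoid = record
              { isSemigroup = record
                { isMagma = record { isEquivalence = ≈-isEquivalence ; ∙-cong = +-cong }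
                ; assoc = λ x y z → pointwise⇒≈ λ n → ℚ.+-assoc (seq x n) (seq y n) (seq z n)
                }
              ; identity = (λ x → pointwise⇒≈ λ n → ℚ.+-identityˡ (seq x n))
                         , (λ x → pointwise⇒≈ λ n → ℚ.+-identityʳ (seq x n))
              }
            ; inverse = (λ x → pointwise⇒≈ λ n → ℚ.+-inverseˡ (seq x n))
                      , (λ x → pointwise⇒≈ λ n → ℚ.+-inverseʳ (seq x n))
            ; ⁻¹-cong = -‿cong
            }
          ; comm = λ x y → pointwise⇒≈ λ n → ℚ.+-comm (seq x n) (seq y n)
          }
        ; *-cong = *-cong
        ; *-assoc = λ x y z → pointwise⇒≈ λ n → ℚ.*-assoc (seq x n) (seq y n) (seq z n)
        ; *-identity = (λ x → pointwise⇒≈ λ n → ℚ.*-identityˡ (seq x n))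
                     , (λ x → pointwise⇒≈ λ n → ℚ.*-identityʳ (seq x n))
        ; distrib = (λ x y z → pointwise⇒≈ λ n → ℚ.*-distribˡ-+ (seq x n) (seq y n) (seq z n))
                  , (λ x y z → pointwise⇒≈ λ n → ℚ.*-distribʳ-+ (seq x n) (seq y n) (seq z n))
        }
      ; *-comm = λ x y → pointwise⇒≈ λ n → ℚ.*-comm (seq x n) (seq y n)
      }

    #-irrefl : x ≈ y → ¬ x # y
    #-irrefl (mk≈ x≈y) (mk# η 0<η x#y) =
      let N , contra = both (λ p q → ℚ.<-irrefl ≡.refl (ℚ.<-≤-trans p q)) (x≈y 0<η) x#y
      in contra ℕ.≤-refl

    #-sym : x # y → y # x
    #-sym {x} {y} (mk# η 0<η (N , apart)) = mk# η 0<η (N , λ {n} N≤n →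
      ≡.subst (η ℚ.≤_) (∣p-q∣≡∣q-p∣ (seq x n) (seq y n)) (apart N≤n))

    close⊎# : ∀ x y {ε} → 0ℚ ℚ.< ε →
      (∃[ N ] ∀ {n} → N ℕ.≤ n → ℚ.∣ seq x n ℚ.- seq y n ∣ ℚ.< ε) ⊎ x # y
    close⊎# x y {ε} 0<ε =
      let N , close = IsCauchy.eventually-close (isCauchy (x - y)) (0<½* (0<½* 0<ε))
      in compare N (λ {n} N≤n → close N≤n ℕ.≤-refl) (ℚ.∣ d N ∣ ℚ.<? ½ ℚ.* ε)
      where
      d : ℕ → ℚ
      d = seq (x - y)
      compare : ∀ N → (∀ {n} → N ℕ.≤ n → ℚ.∣ d n ℚ.- d N ∣ ℚ.< ½ ℚ.* (½ ℚ.* ε)) →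
                Dec (ℚ.∣ d N ∣ ℚ.< ½ ℚ.* ε) →
                (∃[ N ] ∀ {n} → N ℕ.≤ n → ℚ.∣ d n ∣ ℚ.< ε) ⊎ x # y
      compare N close (yes ∣d∣<½ε) = inj₁ (N , λ {n} N≤n → ℚ.≤-<-trans
        (∣p∣≤∣q∣+∣p-q∣ (d n) (d N))
        (+-halves ∣d∣<½ε (ℚ.<-trans (close N≤n) (½*-<-self (0<½* 0<ε)))))
      compare N close (no ∣d∣≮½ε) = inj₂ (mk# (½ ℚ.* (½ ℚ.* ε)) (0<½* (0<½* 0<ε)) (N , λ {n} N≤n →
        ∣p∣-lower {q = d N} {p = d n} (ℚ.≮⇒≥ ∣d∣≮½ε) (close N≤n)))

    #-cotrans : Cotransitive _#_
    #-cotrans {x} {y} (mk# η 0<η x#y) z = Sum.swap (Sum.map₁ z#y (close⊎# x z (0<½* 0<η)))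
      where
      z#y : (∃[ N ] ∀ {n} → N ℕ.≤ n → ℚ.∣ seq x n ℚ.- seq z n ∣ ℚ.< ½ ℚ.* η) → z # y
      z#y x≈z = mk# (½ ℚ.* η) (0<½* 0<η)
        (both (λ {n} close apart → ℚ.≮⇒≥ λ z≈y → ℚ.<-irrefl ≡.refl
                 (ℚ.≤-<-trans apart (∣p-r∣<ε {seq x n} {seq z n} {_} {seq y n} close z≈y)))
              x≈z x#y)

    #-tight : Tight _≈_ _#_
    #-tight x y = (λ ¬x#y → mk≈ λ 0<ε → Sum.fromInj₁ (λ x#y → contradiction x#y ¬x#y) (close⊎# x y 0<ε))
                , #-irrefl

    invertible⇒# : Invertible _≈_ 1# _*_ (x - y) → x # y
    invertible⇒# {x} {y} (r , mk≈ r*d≈1 , _) =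
      let B , 0<B , bound = eventually-bounded (isCauchy r)
          δ , 0<δ , Bδ≡½ = divide 0<B (ℚ.positive⁻¹ ½)
      in mk# δ 0<δ (both (λ {n} → apart B δ 0<B Bδ≡½ (seq r n) (seq (x - y) n))
                         bound (r*d≈1 (ℚ.positive⁻¹ ½)))
      where
      apart : ∀ B δ → 0ℚ ℚ.< B → B ℚ.* δ ≡ ½ → ∀ p q →
              ℚ.∣ p ∣ ℚ.≤ B → ℚ.∣ p ℚ.* q ℚ.- 1ℚ ∣ ℚ.< ½ → δ ℚ.≤ ℚ.∣ q ∣
      apart B δ 0<B Bδ≡½ p q ∣p∣≤B pq≈1 = ℚ.≮⇒≥ λ ∣q∣<δ → ℚ.<-irrefl ≡.refl
        (ℚ.<-≤-trans (≡.subst (ℚ.∣ p ℚ.* q ∣ ℚ.<_) Bδ≡½ (∣*∣<* 0<B ∣p∣≤B ∣q∣<δ))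
                     (∣p∣-lower {1ℚ} {1ℚ} {p ℚ.* q} ℚ.≤-refl pq≈1))

  #⇒invertible : x # y → Invertible _≈_ 1# _*_ (x - y)
  #⇒invertible {x} {y} (mk# η 0<η x#y@(N , apart)) = r , r*d≈1 , ≈-trans (*-comm (x - y) r) r*d≈1
    where
    open IsCommutativeRing isCommutativeRing using (*-comm)
    r : ℝ
    r = mkℝ (λ n → recip (seq (x - y) n)) (recip-isCauchy 0<η x#y (isCauchy (x - y)))
    abstract
      r*d≈1 : r * (x - y) ≈ 1#
      r*d≈1 = mk≈ λ 0<ε → N , λ {n} N≤n → ≡.subst (ℚ._< _)
        (≡.cong (λ p → ℚ.∣ p ℚ.- 1ℚ ∣) (≡.sym (recip-inverseˡ (≤∣∣⇒≢0 0<η (apart N≤n))))) 0<ε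

  isHeytingField : IsHeytingField _≈_ _#_ _+_ _*_ -_ 0# 1#
  isHeytingField = record
    { isHeytingCommutativeRing = record
      { isCommutativeRing   = isCommutativeRing
      ; isApartnessRelation = record { irrefl = #-irrefl ; sym = #-sym ; cotrans = #-cotrans }
      ; #⇒invertible        = #⇒invertible
      ; invertible⇒#        = invertible⇒#
      }
    ; tight = #-tight
    }

  heytingField : HeytingField 0ℓ 0ℓ 0ℓ
  heytingField = record { isHeytingField = isHeytingField }

  abstract
    x#0⊎y#0⇒x²+y²#0 : x # 0# ⊎ y # 0# → x * x + y * y # 0#
    x#0⊎y#0⇒x²+y²#0 {x} {y} = Sum.[ (λ x#0 → go x y x#0) , (λ y#0 → #-congʳ (+-comm (y * y) (x * x)) (go y x y#0)) ]
      where
      open HeytingProperties (HeytingField.heytingCommutativeRing heytingField) using (#-congʳ)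
      open IsCommutativeRing isCommutativeRing using (+-comm)
      0≤q*q : ∀ q → 0ℚ ℚ.≤ q ℚ.* q
      0≤q*q q = ≡.subst (0ℚ ℚ.≤_) (∣q∣²≡q² q) (ℚ.nonNegative⁻¹ _
        {{ℚ.nonNeg*nonNeg⇒nonNeg ℚ.∣ q ∣ {{ℚ.∣-∣-nonNeg q}} ℚ.∣ q ∣ {{ℚ.∣-∣-nonNeg q}}}})
        where
        ∣q∣²≡q² : ∀ q → ℚ.∣ q ∣ ℚ.* ℚ.∣ q ∣ ≡ q ℚ.* q
        ∣q∣²≡q² q with ℚ.∣p∣≡p∨∣p∣≡-p q
        ... | inj₁ eq rewrite eq = ≡.refl
        ... | inj₂ eq rewrite eq = +-*-Solver.solve 1 (λ q → (:- q) :* (:- q) := q :* q) ≡.refl q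
          where open +-*-Solver
      go : ∀ x y → x # 0# → x * x + y * y # 0#
      go x y (mk# η 0<η (N , apart)) = mk# (η ℚ.* η) (0<* 0<η 0<η) (N , λ {n} N≤n →
        bound (seq x n) (seq y n) (apart N≤n))
        where
        open ℚ.≤-Reasoning
        bound : ∀ p q → η ℚ.≤ ℚ.∣ p ℚ.- 0ℚ ∣ → η ℚ.* η ℚ.≤ ℚ.∣ (p ℚ.* p ℚ.+ q ℚ.* q) ℚ.- 0ℚ ∣
        bound p q η≤ = begin
          η ℚ.* η
            ≤⟨ ℚ.*-monoʳ-≤-nonNeg η {{ℚ.pos⇒nonNeg η {{ℚ.positive 0<η}}}} η≤∣p∣ ⟩
          ℚ.∣ p ∣ ℚ.* η
            ≤⟨ ℚ.*-monoˡ-≤-nonNeg ℚ.∣ p ∣ {{ℚ.∣-∣-nonNeg p}} η≤∣p∣ ⟩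
          ℚ.∣ p ∣ ℚ.* ℚ.∣ p ∣                         ≡⟨ ℚ.∣p*q∣≡∣p∣*∣q∣ p p ⟨
          ℚ.∣ p ℚ.* p ∣                               ≡⟨ ℚ.0≤p⇒∣p∣≡p (0≤q*q p) ⟩
          p ℚ.* p                                     ≡⟨ ℚ.+-identityʳ _ ⟨
          p ℚ.* p ℚ.+ 0ℚ                              ≤⟨ ℚ.+-monoʳ-≤ (p ℚ.* p) (0≤q*q q) ⟩
          p ℚ.* p ℚ.+ q ℚ.* q                         ≡⟨ ℚ.0≤p⇒∣p∣≡p (ℚ.+-mono-≤ (0≤q*q p) (0≤q*q q)) ⟨
          ℚ.∣ p ℚ.* p ℚ.+ q ℚ.* q ∣                   ≡⟨ ≡.cong ℚ.∣_∣ (ℚ.+-identityʳ _) ⟨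
          ℚ.∣ (p ℚ.* p ℚ.+ q ℚ.* q) ℚ.- 0ℚ ∣          ∎
          where
          η≤∣p∣ : η ℚ.≤ ℚ.∣ p ∣
          η≤∣p∣ = ≡.subst (λ p → η ℚ.≤ ℚ.∣ p ∣) (ℚ.+-identityʳ p) η≤

module Field {c ℓ₁ ℓ₂} (F : HeytingField c ℓ₁ ℓ₂) where
  open HeytingField F
  open HeytingProperties heytingCommutativeRing

  commutativeRing : CommutativeRing c ℓ₁
  commutativeRing = record { isCommutativeRing = isCommutativeRing }

  open CommutativeRing commutativeRing using (semiring)
  open import Algebra.Properties.Semiring.Exp semiring public using (_^_)

  inverse : ∀ x → x # 0# → Carrier
  inverse x x#0 = proj₁ (#⇒invertible x#0)

  *-inverseˡ : ∀ x (x#0 : x # 0#) → inverse x x#0 * x ≈ 1#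
  *-inverseˡ x x#0 = trans (*-congˡ (sym (x-0≈x x))) (proj₁ (proj₂ (#⇒invertible x#0)))

  x#y⇒x-y#0 : ∀ {x y} → x # y → x - y # 0#
  x#y⇒x-y#0 {x} {y} x#y with #⇒invertible x#y
  ... | i , i*[x-y]≈1 , _ = invertibleˡ⇒# (i , trans (*-congˡ (x-0≈x (x - y))) i*[x-y]≈1)

  x#0⇒x^n#0 : ∀ {x} → x # 0# → ∀ n → x ^ n # 0#
  x#0⇒x^n#0 x#0 zero    = 1#0
  x#0⇒x^n#0 x#0 (suc n) = x#0y#0→xy#0 x#0 (x#0⇒x^n#0 x#0 n)

-- The condition under which adjoining a square root of -1 to F yields a field.

SumsOfTwoSquares#0 : ∀ {c ℓ₁ ℓ₂} → HeytingField c ℓ₁ ℓ₂ → Set (c ⊔ ℓ₂)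
SumsOfTwoSquares#0 F = ∀ {x y} → x # 0# ⊎ y # 0# → x * x + y * y # 0#
  where open HeytingField F

record Complex {c} (A : Set c) : Set c where
  constructor _+i_
  field
    re im : A

open Complex public

module Complexification {c ℓ₁ ℓ₂} (F : HeytingField c ℓ₁ ℓ₂)
  (x#0⊎y#0⇒x²+y²#0 : SumsOfTwoSquares#0 F) where

  open HeytingField F
  open HeytingProperties heytingCommutativeRing
  private
    module F = HeytingField F
    R = Field.commutativeRing F
    module R = CommutativeRing R
  open RingProperties R.ring using (-0#≈0#; -‿distribˡ-*; -‿involutive; -1*x≈-x)
  open SemiringSolver R.commutativeSemiring using (solve; _:+_; _:*_; _:=_)
  open import Relation.Binary.Reasoning.Setoid R.setoid

  infix 4 _≈ᶜ_ _#ᶜ_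

  record _≈ᶜ_ (z w : Complex Carrier) : Set ℓ₁ where
    constructor _,_
    field
      re≈ : re z ≈ re w
      im≈ : im z ≈ im w

  data _#ᶜ_ (z w : Complex Carrier) : Set ℓ₂ where
    re# : re z # re w → z #ᶜ w
    im# : im z # im w → z #ᶜ w

  embed : Carrier → Complex Carrier
  embed x = x +i 0#

  0ᶜ 1ᶜ : Complex Carrier
  0ᶜ = embed 0#
  1ᶜ = embed 1#

  infixl 6 _+ᶜ_ _-ᶜ_
  infixl 7 _*ᶜ_

  _+ᶜ_ _*ᶜ_ : Complex Carrier → Complex Carrier → Complex Carrier
  (x +i y) +ᶜ (u +i v) = (x + u) +i (y + v)
  (x +i y) *ᶜ (u +i v) = (x * u - y * v) +i (x * v + y * u)

  -ᶜ_ : Complex Carrier → Complex Carrier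
  -ᶜ z = (- re z) +i (- im z)

  _-ᶜ_ : Complex Carrier → Complex Carrier → Complex Carrier
  z -ᶜ w = z +ᶜ (-ᶜ w)

  ≈ᶜ-isEquivalence : IsEquivalence _≈ᶜ_
  ≈ᶜ-isEquivalence = record
    { refl  = refl , refl
    ; sym   = λ (p , q) → sym p , sym q
    ; trans = λ (p , q) (r , s) → trans p r , trans q s
    }

  -- With -1 as an additional variable, the semiring solver suffices below.
  private
    x-y≈x+[-1]y : ∀ x y → x - y ≈ x + (- 1#) * y
    x-y≈x+[-1]y x y = +-congˡ (sym (-1*x≈-x y))

  abstract
    *ᶜ-cong : ∀ {z w s t} → z ≈ᶜ w → s ≈ᶜ t → z *ᶜ s ≈ᶜ w *ᶜ t
    *ᶜ-cong (p , q) (r , s) =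
        +-cong (*-cong p r) (-‿cong (*-cong q s))
      , +-cong (*-cong p s) (*-cong q r)

    *ᶜ-comm : ∀ z w → z *ᶜ w ≈ᶜ w *ᶜ z
    *ᶜ-comm (x +i y) (u +i v) =
        +-cong (*-comm x u) (-‿cong (*-comm y v))
      , trans (+-comm (x * v) (y * u)) (+-cong (*-comm y u) (*-comm x v))

    *ᶜ-assoc : ∀ z w t → (z *ᶜ w) *ᶜ t ≈ᶜ z *ᶜ (w *ᶜ t)
    *ᶜ-assoc (x +i y) (u +i v) (p +i q) =
        (begin
          (x * u - y * v) * p - (x * v + y * u) * q
            ≈⟨ x-y≈x+[-1]y _ _ ⟩
          (x * u - y * v) * p + (- 1#) * ((x * v + y * u) * q)
            ≈⟨ +-congʳ (*-congʳ (x-y≈x+[-1]y _ _)) ⟩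
          (x * u + (- 1#) * (y * v)) * p + (- 1#) * ((x * v + y * u) * q)
            ≈⟨ solve 7 (λ n x y u v p q →
                   ((x :* u :+ n :* (y :* v)) :* p :+ n :* ((x :* v :+ y :* u) :* q))
                 := (x :* (u :* p :+ n :* (v :* q)) :+ n :* (y :* (u :* q :+ v :* p))))
                 refl (- 1#) x y u v p q ⟩
          x * (u * p + (- 1#) * (v * q)) + (- 1#) * (y * (u * q + v * p))
            ≈⟨ +-congʳ (*-congˡ (x-y≈x+[-1]y _ _)) ⟨
          x * (u * p - v * q) + (- 1#) * (y * (u * q + v * p))
            ≈⟨ x-y≈x+[-1]y _ _ ⟨
          x * (u * p - v * q) - y * (u * q + v * p) ∎)
      , (begin
          (x * u - y * v) * q + (x * v + y * u) * p
            ≈⟨ +-congʳ (*-congʳ (x-y≈x+[-1]y _ _)) ⟩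
          (x * u + (- 1#) * (y * v)) * q + (x * v + y * u) * p
            ≈⟨ solve 7 (λ n x y u v p q →
                   ((x :* u :+ n :* (y :* v)) :* q :+ (x :* v :+ y :* u) :* p)
                 := (x :* (u :* q :+ v :* p) :+ y :* (u :* p :+ n :* (v :* q))))
                 refl (- 1#) x y u v p q ⟩
          x * (u * q + v * p) + y * (u * p + (- 1#) * (v * q))
            ≈⟨ +-congˡ (*-congˡ (x-y≈x+[-1]y _ _)) ⟨
          x * (u * q + v * p) + y * (u * p - v * q) ∎)

    *ᶜ-identityˡ : ∀ z → 1ᶜ *ᶜ z ≈ᶜ z
    *ᶜ-identityˡ (x +i y) =
        trans (+-cong (*-identityˡ x) (trans (-‿cong (zeroˡ y)) -0#≈0#)) (+-identityʳ x)
      , trans (+-cong (*-identityˡ y) (zeroˡ x)) (+-identityʳ y)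

    *ᶜ-distribˡ-+ᶜ : ∀ z w t → z *ᶜ (w +ᶜ t) ≈ᶜ (z *ᶜ w) +ᶜ (z *ᶜ t)
    *ᶜ-distribˡ-+ᶜ (x +i y) (u +i v) (p +i q) =
        (begin
          x * (u + p) - y * (v + q)
            ≈⟨ x-y≈x+[-1]y _ _ ⟩
          x * (u + p) + (- 1#) * (y * (v + q))
            ≈⟨ solve 7 (λ n x y u v p q →
                   (x :* (u :+ p) :+ n :* (y :* (v :+ q)))
                 := ((x :* u :+ n :* (y :* v)) :+ (x :* p :+ n :* (y :* q))))
                 refl (- 1#) x y u v p q ⟩
          (x * u + (- 1#) * (y * v)) + (x * p + (- 1#) * (y * q))
            ≈⟨ +-cong (x-y≈x+[-1]y _ _) (x-y≈x+[-1]y _ _) ⟨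
          (x * u - y * v) + (x * p - y * q) ∎)
      , solve 6 (λ x y u v p q →
            (x :* (v :+ q) :+ y :* (u :+ p))
          := ((x :* v :+ y :* u) :+ (x :* q :+ y :* p))) refl x y u v p q

    isCommutativeRingᶜ : IsCommutativeRing _≈ᶜ_ _+ᶜ_ _*ᶜ_ -ᶜ_ 0ᶜ 1ᶜ
    isCommutativeRingᶜ = record
      { isRing = record
        { +-isAbelianGroup = record
          { isGroup = record
            { isMonoid = record
              { isSemigroup = record
                { isMagma = record
                  { isEquivalence = ≈ᶜ-isEquivalence
                  ; ∙-cong = λ (p , q) (r , s) → +-cong p r , +-cong q s
                  }
                ; assoc = λ z w t → +-assoc (re z) (re w) (re t) , +-assoc (im z) (im w) (im t)
                }
              ; identity = (λ z → +-identityˡ (re z) , +-identityˡ (im z))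
                         , (λ z → +-identityʳ (re z) , +-identityʳ (im z))
              }
            ; inverse = (λ z → -‿inverseˡ (re z) , -‿inverseˡ (im z))
                      , (λ z → -‿inverseʳ (re z) , -‿inverseʳ (im z))
            ; ⁻¹-cong = λ (p , q) → -‿cong p , -‿cong q
            }
          ; comm = λ z w → +-comm (re z) (re w) , +-comm (im z) (im w)
          }
        ; *-cong = *ᶜ-cong
        ; *-assoc = *ᶜ-assoc
        ; *-identity = *ᶜ-identityˡ , λ z → C.trans (*ᶜ-comm z 1ᶜ) (*ᶜ-identityˡ z)
        ; distrib = *ᶜ-distribˡ-+ᶜ , λ z w t → C.trans (*ᶜ-comm (w +ᶜ t) z)
            (C.trans (*ᶜ-distribˡ-+ᶜ z w t)
                     (+-cong (_≈ᶜ_.re≈ (*ᶜ-comm z w)) (_≈ᶜ_.re≈ (*ᶜ-comm z t))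
                    , +-cong (_≈ᶜ_.im≈ (*ᶜ-comm z w)) (_≈ᶜ_.im≈ (*ᶜ-comm z t))))
        }
      ; *-comm = *ᶜ-comm
      }
      where module C = IsEquivalence ≈ᶜ-isEquivalence

  private
    norm : Complex Carrier → Carrier
    norm z = re z * re z + im z * im z

    norm#0 : ∀ {z w} → z #ᶜ w → norm (z -ᶜ w) # 0#
    norm#0 (re# x#u) = x#0⊎y#0⇒x²+y²#0 (inj₁ (Field.x#y⇒x-y#0 F x#u))
    norm#0 (im# y#v) = x#0⊎y#0⇒x²+y²#0 (inj₂ (Field.x#y⇒x-y#0 F y#v))

    #ᶜ-irrefl : ∀ {z w} → z ≈ᶜ w → ¬ z #ᶜ w
    #ᶜ-irrefl (p , q) (re# x#u) = #-irrefl p x#u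
    #ᶜ-irrefl (p , q) (im# y#v) = #-irrefl q y#v

    #ᶜ-sym : ∀ {z w} → z #ᶜ w → w #ᶜ z
    #ᶜ-sym (re# x#u) = re# (#-sym x#u)
    #ᶜ-sym (im# y#v) = im# (#-sym y#v)

    #ᶜ-cotrans : Cotransitive _#ᶜ_
    #ᶜ-cotrans (re# x#u) t = Sum.map re# re# (#-cotrans x#u (re t))
    #ᶜ-cotrans (im# y#v) t = Sum.map im# im# (#-cotrans y#v (im t))

  #ᶜ⇒invertible : ∀ {z w} → z #ᶜ w → Invertible _≈ᶜ_ 1ᶜ _*ᶜ_ (z -ᶜ w)
  #ᶜ⇒invertible {z} {w} z#w = i , i*d≈1 ,
    IsEquivalence.trans ≈ᶜ-isEquivalence (*ᶜ-comm (z -ᶜ w) i) i*d≈1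
    where
    d = z -ᶜ w
    m = Field.inverse F (norm d) (norm#0 z#w)
    i = (m * re d) +i (- (m * im d))
    abstract
      i*d≈1 : i *ᶜ d ≈ᶜ 1ᶜ
      i*d≈1 =
          (begin
            m * re d * re d - - (m * im d) * im d
              ≈⟨ +-congˡ (-‿cong (-‿distribˡ-* (m * im d) (im d))) ⟨
            m * re d * re d - - (m * im d * im d)
              ≈⟨ +-congˡ (-‿involutive (m * im d * im d)) ⟩
            m * re d * re d + m * im d * im d
              ≈⟨ solve 3 (λ m x y → (m :* x :* x :+ m :* y :* y) := (m :* (x :* x :+ y :* y)))
                   refl m (re d) (im d) ⟩
            m * norm d   ≈⟨ Field.*-inverseˡ F (norm d) (norm#0 z#w) ⟩
            1#           ∎)
        , (begin
            m * re d * im d + - (m * im d) * re d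
              ≈⟨ +-congˡ (-‿distribˡ-* (m * im d) (re d)) ⟨
            m * re d * im d - m * im d * re d
              ≈⟨ +-congʳ (solve 3 (λ m x y → (m :* x :* y) := (m :* y :* x)) refl m (re d) (im d)) ⟩
            m * im d * re d - m * im d * re d   ≈⟨ -‿inverseʳ _ ⟩
            0#                                  ∎)

  abstract
    invertibleᶜ⇒# : ∀ {z w} → Invertible _≈ᶜ_ 1ᶜ _*ᶜ_ (z -ᶜ w) → z #ᶜ w
    invertibleᶜ⇒# {z} {w} (p +i q , (re≈1 , _) , _) =
      Sum.[ re# ∘ factor p , im# ∘ factor (- q) ] (split {p * x} (#-congʳ (sym px-qy≈1) 1#0))
      where
      x y : Carrier
      x = re z - re w
      y = im z - im w
      px-qy≈1 : p * x + (- q) * y ≈ 1#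
      px-qy≈1 = trans (+-congˡ (sym (-‿distribˡ-* q y))) re≈1
      factor : ∀ r {s t} → r * (s - t) # 0# → s # t
      factor r {s} {t} rd#0 with #⇒invertible rd#0
      ... | i , i*rd≈1 , _ = invertibleˡ⇒# (i * r , (begin
        i * r * (s - t)            ≈⟨ *-assoc i r (s - t) ⟩
        i * (r * (s - t))          ≈⟨ *-congˡ (x-0≈x (r * (s - t))) ⟨
        i * (r * (s - t) - 0#)     ≈⟨ i*rd≈1 ⟩
        1#                         ∎))
      split : ∀ {s t} → s + t # 0# → s # 0# ⊎ t # 0#
      split {s} {t} s+t#0 = Sum.map₁ cancel (#-cotrans s+t#0 t)
        where
        cancel : s + t # t → s # 0#
        cancel s+t#t with #⇒invertible s+t#t
        ... | i , i*≈1 , _ = invertibleˡ⇒# (i , trans (*-congˡ (begin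
          s - 0#        ≈⟨ x-0≈x s ⟩
          s             ≈⟨ +-identityʳ s ⟨
          s + 0#        ≈⟨ +-congˡ (-‿inverseʳ t) ⟨
          s + (t - t)   ≈⟨ +-assoc s t (- t) ⟨
          s + t - t     ∎)) i*≈1)

  heytingFieldᶜ : HeytingField c ℓ₁ ℓ₂
  heytingFieldᶜ = record
    { isHeytingField = record
      { isHeytingCommutativeRing = record
        { isCommutativeRing   = isCommutativeRingᶜ
        ; isApartnessRelation = record
          { irrefl  = #ᶜ-irrefl
          ; sym     = #ᶜ-sym
          ; cotrans = #ᶜ-cotrans
          }
        ; #⇒invertible = #ᶜ⇒invertible
        ; invertible⇒# = invertibleᶜ⇒#
        }
      ; tight = λ z w →
            (λ ¬z#w → proj₁ (tight (re z) (re w)) (¬z#w ∘ re#)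
                    , proj₁ (tight (im z) (im w)) (¬z#w ∘ im#))
          , #ᶜ-irrefl
      }
    }

Matrix : ∀ {c} → Set c → ℕ → Set c
Matrix A n = Vector (Vector A n) n

mapᴹ : ∀ {c d} {A : Set c} {B : Set d} {n} → (A → B) → Matrix A n → Matrix B n
mapᴹ f M i j = f (M i j)

⟦_,_∣_,_⟧ : ∀ {c} {A : Set c} → A → A → A → A → Matrix A 2
⟦ p , q ∣ r , s ⟧ = (p ∷ q ∷ []) ∷ (r ∷ s ∷ []) ∷ []

module Matrices {c ℓ} (R : CommutativeRing c ℓ) where
  open CommutativeRing R
  open import Algebra.Properties.Semiring.Sum semiring using (sum)

  infix  4 _≈ᴹ_
  infixl 6 _+ᴹ_ _-ᴹ_
  infixl 7 _*ᴹ_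
  infixr 7 _•_

  private variable
    n : ℕ

  _≈ᴹ_ : Matrix Carrier n → Matrix Carrier n → Set ℓ
  M ≈ᴹ N = ∀ i j → M i j ≈ N i j

  0ᴹ 1ᴹ : Matrix Carrier n
  0ᴹ i j = 0#
  1ᴹ i j = if does (i Fin.≟ j) then 1# else 0#

  _•_ : Carrier → Matrix Carrier n → Matrix Carrier n
  (x • M) i j = x * M i j

  _+ᴹ_ _-ᴹ_ _*ᴹ_ : Matrix Carrier n → Matrix Carrier n → Matrix Carrier n
  (M +ᴹ N) i j = M i j + N i j
  (M -ᴹ N) i j = M i j - N i j
  (M *ᴹ N) i j = sum λ k → M i k * N k j

  rawSemiringᴹ : ℕ → RawSemiring c ℓ
  rawSemiringᴹ n = record
    { Carrier = Matrix Carrier n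
    ; _≈_ = _≈ᴹ_
    ; _+_ = _+ᴹ_
    ; _*_ = _*ᴹ_
    ; 0#  = 0ᴹ
    ; 1#  = 1ᴹ
    }

  infixr 8 _^ᴹ_

  _^ᴹ_ : Matrix Carrier n → ℕ → Matrix Carrier n
  _^ᴹ_ {n} = RawSemiringDefinitions._^_ (rawSemiringᴹ n)

open Real using (fromℚ)
open HeytingField Real.heytingField public
  using (_≈_; _#_; _+_; _*_; -_; _-_; 0#; 1#)
open Field Real.heytingField public using (_^_; inverse)
open Matrices (Field.commutativeRing Real.heytingField) public

ℂ-heytingField : HeytingField 0ℓ 0ℓ 0ℓ
ℂ-heytingField = Complexification.heytingFieldᶜ Real.heytingField Real.x#0⊎y#0⇒x²+y²#0

ℂ : Set
ℂ = Complex ℝ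

open HeytingField ℂ-heytingField public
  using ()
  renaming (_≈_ to _≈ᶜ_; _#_ to _#ᶜ_; _+_ to _+ᶜ_; _*_ to _*ᶜ_; _-_ to _-ᶜ_; 0# to 0ᶜ)
open Field ℂ-heytingField public
  using ()
  renaming (_^_ to _^ᶜ_; inverse to inverseᶜ)
open Matrices (Field.commutativeRing ℂ-heytingField) public
  using ()
  renaming (_≈ᴹ_ to _≈ᶜᴹ_; _+ᴹ_ to _+ᶜᴹ_; _•_ to _•ᶜ_; _*ᴹ_ to _*ᶜᴹ_; _^ᴹ_ to _^ᶜᴹ_)

ι : ℝ → ℂ
ι = Complexification.embed Real.heytingField Real.x#0⊎y#0⇒x²+y²#0

ε : ℕ → ℕ
ε n = n % 2

two : ℝ
two = fromℚ (+ 2 ℚ./ 1)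

module BiPeriodicJacobsthal (a b : ℝ) (a#0 : a # 0#) (b#0 : b # 0#) where

  J : ℕ → Matrix ℝ 2
  J 0             = ⟦ 1# , 0#
                    ∣ 0# , 1# ⟧
  J 1             = ⟦ b  , two * (b * inverse a a#0)
                    ∣ 1# , 0# ⟧
  J (suc (suc n)) = (if ε (suc (suc n)) ≡ᵇ 0 then a else b) • J (suc n) +ᴹ two • J n

  discriminant : ℝ
  discriminant = a ^ 2 * b ^ 2 + fromℚ (+ 8 ℚ./ 1) * (a * b)

  -- √Δ is to be a square root of the discriminant.  It is complex because the
  -- discriminant may be negative; passing to the other root exchanges α and β.
  module Binet (√Δ : ℂ) where

    α β : ℂ
    α = ι (fromℚ ½) *ᶜ (ι (a * b) +ᶜ √Δ)
    β = ι (fromℚ ½) *ᶜ (ι (a * b) -ᶜ √Δ)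

    -- α # β says that the discriminant does not vanish, as division by α - β demands.
    module Coefficients (α#β : α #ᶜ β) where

      denominator : ℕ → ℂ
      denominator k = ι (a * b) ^ᶜ k *ᶜ (α -ᶜ β)

      denominator#0 : ∀ k → denominator k #ᶜ 0ᶜ
      denominator#0 k =
        x#0y#0→xy#0 (Field.x#0⇒x^n#0 ℂ-heytingField ab#0 k) (Field.x#y⇒x-y#0 ℂ-heytingField α#β)
        where
        open HeytingProperties (HeytingField.heytingCommutativeRing ℂ-heytingField)
        ab#0 : ι (a * b) #ᶜ 0ᶜ
        ab#0 = Complexification.re# (HeytingProperties.x#0y#0→xy#0
          (HeytingField.heytingCommutativeRing Real.heytingField) a#0 b#0)

      1/denominator : ℕ → ℂ
      1/denominator k = inverseᶜ (denominator k) (denominator#0 k)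

      A B A-entries B-entries : ℕ → Matrix ℂ 2
      A n = 1/denominator ⌊ n /2⌋ •ᶜ mapᴹ ι
              ( (J 1 -ᴹ b • J 0) ^ᴹ ε n
              *ᴹ (a • J 1 -ᴹ two • J 0 -ᴹ (a * b) • J 0) ^ᴹ (1 ∸ ε n) )
      B n = 1/denominator (⌊ n /2⌋ ℕ.+ 1) •ᶜ mapᴹ ι (b ^ ε n • J 0)

      A-entries n = 1/denominator ⌊ n /2⌋ •ᶜ mapᴹ ι
        ( ⟦ 0# , two * (b * inverse a a#0)
          ∣ 1# , - b ⟧ ^ᴹ ε n
        *ᴹ ⟦ - two , two * b
           ∣ a     , - two - a * b ⟧ ^ᴹ (1 ∸ ε n) )
      B-entries n = (ι (b ^ ε n) *ᶜ 1/denominator (⌊ n /2⌋ ℕ.+ 1)) •ᶜ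
        mapᴹ ι ⟦ 1# , 0#
               ∣ 0# , 1# ⟧

{-# OPTIONS --safe #-}
module Submission where

-- Fix an entry x n of J n and let U n = αⁿ - βⁿ and s = ab.  Since α and β are roots of
-- X² = sX + 2s, U satisfies U (n+2) = s U (n+1) + 2s U n.  With p = a (x 1) - 2 (x 0) - ab (x 0)
-- and q = x 1 - b (x 0), so that a q = p + 2 (x 0), a simultaneous induction on k gives
--   sᵏ⁺¹ (U 1) x (2k)   = s U (2k)   p + U (2k+2) x 0,
--   sᵏ⁺¹ (U 1) x (2k+1) = s U (2k+1) q + U (2k+2) b (x 0),
-- and it remains to divide by sᵏ⁺¹ (α - β).

open import Data.Bool.Base using (if_then_else_)
open import Data.Fin.Base using (Fin; zero; suc)
open import Data.Integer.Base using (+_)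
open import Data.Nat.Base using (ℕ; zero; suc; ⌊_/2⌋; _∸_; _≡ᵇ_) renaming (_+_ to _+ℕ_; _*_ to _*ℕ_)
import Data.Nat.Properties as ℕ
open import Data.Product.Base using (_×_; _,_)
open import Data.Rational.Base as ℚ using (½)
open import Data.Vec.Functional using (Vector)
open import Relation.Binary.PropositionalEquality as ≡ using (_≡_)
open import Algebra.Bundles using (CommutativeRing)
open import Algebra.Apartness.Bundles using (HeytingField)
import Algebra.Properties.Ring as RingProperties
import Algebra.Solver.Ring.NaturalCoefficients.Default as SemiringSolver
open import Defs using (ε; Matrix; ⟦_,_∣_,_⟧; SumsOfTwoSquares#0; module Matrices; module Field; module Complexification)

-- Parity of an index, its half and its remainder

data Parity : ℕ → Set where
  even : ∀ k → Parity (k *ℕ 2)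
  odd  : ∀ k → Parity (suc (k *ℕ 2))

parity : ∀ n → Parity n
parity 0 = even 0
parity 1 = odd 0
parity (suc (suc n)) with parity n
... | even k = even (suc k)
... | odd k  = odd (suc k)

⌊k*2/2⌋≡k : ∀ k → ⌊ k *ℕ 2 /2⌋ ≡ k
⌊k*2/2⌋≡k zero    = ≡.refl
⌊k*2/2⌋≡k (suc k) = ≡.cong suc (⌊k*2/2⌋≡k k)

⌊1+k*2/2⌋≡k : ∀ k → ⌊ suc (k *ℕ 2) /2⌋ ≡ k
⌊1+k*2/2⌋≡k zero    = ≡.refl
⌊1+k*2/2⌋≡k (suc k) = ≡.cong suc (⌊1+k*2/2⌋≡k k)

ε[k*2]≡0 : ∀ k → ε (k *ℕ 2) ≡ 0
ε[k*2]≡0 zero    = ≡.refl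
ε[k*2]≡0 (suc k) = ε[k*2]≡0 k

ε[1+k*2]≡1 : ∀ k → ε (suc (k *ℕ 2)) ≡ 1
ε[1+k*2]≡1 zero    = ≡.refl
ε[1+k*2]≡1 (suc k) = ε[1+k*2]≡1 k

-- The theorem has the left index; the induction uses the right one because `suc k *ℕ 2` computes to
-- `suc (suc (k *ℕ 2))`.
2*k+2≡2+k*2 : ∀ k → 2 *ℕ k +ℕ 2 ≡ suc (suc (k *ℕ 2))
2*k+2≡2+k*2 k = ≡.trans (ℕ.+-comm (2 *ℕ k) 2) (≡.cong (λ m → suc (suc m)) (ℕ.*-comm 2 k))

-- The scalar Binet formula over a commutative ring

module BinetFormulas {c ℓ} (R : CommutativeRing c ℓ) where
  open CommutativeRing R
  open RingProperties ring using (-‿distribˡ-*; -‿distribʳ-*; -‿involutive; -1*x≈-x)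
  open SemiringSolver commutativeSemiring using (solve; con; _:+_; _:*_; _:=_)
  open import Algebra.Properties.Semiring.Exp semiring using (_^_)
  open import Relation.Binary.Reasoning.Setoid setoid

  -- The quadratic formula for X² = sX + 2s: expanding the square gives h²(2s² + 2sr + 8s), and h =
  -- 1/2. The constants 2, 1/2 and 8 are given up to `≈`, so that their images under `ι` can be
  -- supplied.
  half-sum-root : ∀ {s r t h e} → t ≈ 1# + 1# → h * t ≈ 1# → e ≈ t * (t * t) →
    r * r ≈ s * s + e * s →
    (h * (s + r)) * (h * (s + r)) ≈ s * (h * (s + r)) + t * s
  half-sum-root {s} {r} {t} {h} {e} t≈2 ht≈1 e≈t³ r² = begin
    (h * (s + r)) * (h * (s + r))
      ≈⟨ solve 3 (λ s r h → (h :* (s :+ r)) :* (h :* (s :+ r))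
           := (h :* h) :* ((s :* s :+ (con 1 :+ con 1) :* (s :* r)) :+ r :* r)) refl s r h ⟩
    (h * h) * ((s * s + (1# + 1#) * (s * r)) + r * r)
      ≈⟨ *-congˡ (+-congˡ (trans r² (+-congˡ (*-congʳ e≈t³)))) ⟩
    (h * h) * ((s * s + (1# + 1#) * (s * r)) + (s * s + (t * (t * t)) * s))
      ≈⟨ solve 4 (λ s r t h →
              (h :* h) :* ((s :* s :+ (con 1 :+ con 1) :* (s :* r)) :+ (s :* s :+ (t :* (t :* t)) :* s))
           := (h :* (con 1 :+ con 1)) :* (s :* (h :* (s :+ r))) :+ (h :* t) :* ((h :* t) :* (t :* s)))
           refl s r t h ⟩
    (h * (1# + 1#)) * (s * (h * (s + r))) + (h * t) * ((h * t) * (t * s))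
      ≈⟨ +-cong (*-congʳ (trans (*-congˡ (sym t≈2)) ht≈1)) (*-cong ht≈1 (*-congʳ ht≈1)) ⟩
    1# * (s * (h * (s + r))) + 1# * (1# * (t * s))
      ≈⟨ +-cong (*-identityˡ _) (trans (*-identityˡ _) (*-identityˡ _)) ⟩
    s * (h * (s + r)) + t * s ∎

  -- The previous lemma at `- r`, which has the same square as `r`.
  half-difference-root : ∀ {s r t h e} → t ≈ 1# + 1# → h * t ≈ 1# → e ≈ t * (t * t) →
    r * r ≈ s * s + e * s →
    (h * (s - r)) * (h * (s - r)) ≈ s * (h * (s - r)) + t * s
  half-difference-root {r = r} t≈2 ht≈1 e≈t³ r² = half-sum-root t≈2 ht≈1 e≈t³ (trans -r*-r≈r*r r²)
    where
    -r*-r≈r*r : - r * - r ≈ r * r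
    -r*-r≈r*r = begin
      - r * - r       ≈⟨ -‿distribˡ-* r (- r) ⟨
      - (r * - r)     ≈⟨ -‿cong (-‿distribʳ-* r r) ⟨
      - - (r * r)     ≈⟨ -‿involutive (r * r) ⟩
      r * r           ∎

  -- Multiply the two quadratic equations by αⁿ and βⁿ and subtract. The solver knows only
  -- semirings, so -1 is passed to it as the variable `m`.
  power-difference-step : ∀ {α β s p} → α * α ≈ s * α + p → β * β ≈ s * β + p → ∀ n →
    α ^ suc (suc n) - β ^ suc (suc n) ≈ s * (α ^ suc n - β ^ suc n) + p * (α ^ n - β ^ n)
  power-difference-step {α} {β} {s} {p} α² β² n = begin
    α * (α * A) - β * (β * B)
      ≈⟨ x-y≈x+[-1]y _ _ ⟩
    α * (α * A) + (- 1#) * (β * (β * B))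
      ≈⟨ solve 5 (λ m α β A B → α :* (α :* A) :+ m :* (β :* (β :* B))
           := (α :* α) :* A :+ m :* ((β :* β) :* B)) refl (- 1#) α β A B ⟩
    (α * α) * A + (- 1#) * ((β * β) * B)
      ≈⟨ +-cong (*-congʳ α²) (*-congˡ (*-congʳ β²)) ⟩
    (s * α + p) * A + (- 1#) * ((s * β + p) * B)
      ≈⟨ solve 7 (λ m α β A B s p → (s :* α :+ p) :* A :+ m :* ((s :* β :+ p) :* B)
           := s :* (α :* A :+ m :* (β :* B)) :+ p :* (A :+ m :* B)) refl (- 1#) α β A B s p ⟩
    s * (α * A + (- 1#) * (β * B)) + p * (A + (- 1#) * B)
      ≈⟨ +-cong (*-congˡ (x-y≈x+[-1]y _ _)) (*-congˡ (x-y≈x+[-1]y _ _)) ⟨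
    s * (α * A - β * B) + p * (A - B) ∎
    where
    A = α ^ n
    B = β ^ n
    x-y≈x+[-1]y : ∀ x y → x - y ≈ x + (- 1#) * y
    x-y≈x+[-1]y x y = +-congˡ (sym (-1*x≈-x y))

  even-coefficient : ∀ a b t x₀ x₁ →
    a * (x₁ - b * x₀) ≈ (a * x₁ - t * x₀ - (a * b) * x₀) + t * x₀
  even-coefficient a b t x₀ x₁ = begin
    a * (x₁ - b * x₀)
      ≈⟨ distribˡ a x₁ _ ⟩
    a * x₁ + a * (- (b * x₀))
      ≈⟨ +-congˡ (-‿distribʳ-* a (b * x₀)) ⟨
    a * x₁ - a * (b * x₀)
      ≈⟨ +-congˡ (-‿cong (*-assoc a b x₀)) ⟨
    a * x₁ - (a * b) * x₀
      -- Insert 0 = -(t x₀) + t x₀ to create the missing summand.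
      ≈⟨ +-identityʳ _ ⟨
    (a * x₁ - (a * b) * x₀) + 0#
      ≈⟨ +-congˡ (-‿inverseˡ (t * x₀)) ⟨
    (a * x₁ - (a * b) * x₀) + (- (t * x₀) + t * x₀)
      ≈⟨ solve 4 (λ p q r s → (p :+ q) :+ (r :+ s) := ((p :+ r) :+ q) :+ s) refl _ _ _ _ ⟩
    (a * x₁ - t * x₀ - (a * b) * x₀) + t * x₀ ∎

  -- `Y 0` and `Y 1` are p and q of the outline, packed into one function of the parity so that the
  -- final formula can use `Y (ε n)`.
  module _ {a b t : Carrier} {U x : ℕ → Carrier} {coefficient : ℕ → Carrier}
    (U₀ : U 0 ≈ 0#)
    (U-step : ∀ n → U (suc (suc n)) ≈ (a * b) * U (suc n) + (t * (a * b)) * U n)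
    (coefficient-even : coefficient 0 ≈ a) (coefficient-odd : coefficient 1 ≈ b)
    (x-step : ∀ n → x (suc (suc n)) ≈ coefficient (ε n) * x (suc n) + t * x n)
    {Y : ℕ → Carrier}
    (a*Y₁ : a * Y 1 ≈ Y 0 + t * x 0) (Y₁+ : Y 1 + b * x 0 ≈ x 1)
    where

    private
      s = a * b
      d = U 1
      P = Y 0
      Q = Y 1
      z = x 0

      x-even-step : ∀ k → x (suc (suc (k *ℕ 2))) ≈ a * x (suc (k *ℕ 2)) + t * x (k *ℕ 2)
      x-even-step k = trans (x-step (k *ℕ 2)) (+-congʳ (*-congʳ
        (trans (reflexive (≡.cong coefficient (ε[k*2]≡0 k))) coefficient-even)))

      x-odd-step : ∀ k →
        x (suc (suc (suc (k *ℕ 2)))) ≈ b * x (suc (suc (k *ℕ 2))) + t * x (suc (k *ℕ 2))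
      x-odd-step k = trans (x-step (suc (k *ℕ 2))) (+-congʳ (*-congʳ
        (trans (reflexive (≡.cong coefficient (ε[1+k*2]≡1 k))) coefficient-odd)))

    -- The two statements are proved together: even at k+1 uses both at k, and odd at k+1 uses even
    -- at k+1 and odd at k. Without division, only the recurrences and the relations `a*Y₁` and
    -- `Y₁+` are needed.
    cleared-even : ∀ k → (s ^ suc k * d) * x (k *ℕ 2)
      ≈ s * (U (k *ℕ 2) * P) + U (suc (suc (k *ℕ 2))) * z
    cleared-odd : ∀ k → (s ^ suc k * d) * x (suc (k *ℕ 2))
      ≈ s * (U (suc (k *ℕ 2)) * Q) + U (suc (suc (k *ℕ 2))) * (b * z)

    cleared-even zero = begin
      ((s * 1#) * d) * z
        -- The two inserted zeros stand for `U 0`, so that `U-step 0` can fold the bracket into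
        -- `U 2`.
        ≈⟨ solve 5 (λ s d z p t → ((s :* con 1) :* d) :* z
             := s :* (con 0 :* p) :+ (s :* d :+ (t :* s) :* con 0) :* z) refl s d z P t ⟩
      s * (0# * P) + (s * d + (t * s) * 0#) * z
        ≈⟨ +-cong (*-congˡ (*-congʳ U₀)) (*-congʳ (+-congˡ (*-congˡ U₀))) ⟨
      s * (U 0 * P) + (s * d + (t * s) * U 0) * z
        ≈⟨ +-congˡ (*-congʳ (U-step 0)) ⟨
      s * (U 0 * P) + U 2 * z ∎
    cleared-even (suc k) = begin
      ((s * S) * d) * x (suc (suc m))
        ≈⟨ *-congˡ (x-even-step k) ⟩
      ((s * S) * d) * (a * x (suc m) + t * x m)
        ≈⟨ solve 7 (λ s S d a t p q → ((s :* S) :* d) :* (a :* p :+ t :* q)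
             := s :* (a :* ((S :* d) :* p) :+ t :* ((S :* d) :* q))) refl s S d a t (x (suc m)) (x m) ⟩
      s * (a * ((S * d) * x (suc m)) + t * ((S * d) * x m))
        ≈⟨ *-congˡ (+-cong (*-congˡ (cleared-odd k)) (*-congˡ (cleared-even k))) ⟩
      s * (a * (s * (u₁ * Q) + u₂ * (b * z)) + t * (s * (u₀ * P) + u₂ * z))
        -- Here `s` is expanded as ab, so that the a of the recurrence joins the b of the odd case
        -- to form a further s, and otherwise meets `Q`.
        ≈⟨ solve 9 (λ a b t u₀ u₁ u₂ p q z → let s = a :* b in
                s :* (a :* (s :* (u₁ :* q) :+ u₂ :* (b :* z)) :+ t :* (s :* (u₀ :* p) :+ u₂ :* z))
             := s :* (s :* (u₁ :* (a :* q)) :+ (s :* u₂ :+ t :* u₂) :* z :+ t :* (s :* (u₀ :* p))))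
             refl a b t u₀ u₁ u₂ P Q z ⟩
      s * (s * (u₁ * (a * Q)) + (s * u₂ + t * u₂) * z + t * (s * (u₀ * P)))
        ≈⟨ *-congˡ (+-congʳ (+-congʳ (*-congˡ (*-congˡ a*Y₁)))) ⟩
      s * (s * (u₁ * (P + t * z)) + (s * u₂ + t * u₂) * z + t * (s * (u₀ * P)))
        -- Collecting the coefficients of `P` and `z` exposes the recurrence for `U`: once for `P`,
        -- twice nested for `z`.
        ≈⟨ solve 7 (λ s t u₀ u₁ u₂ p z →
                s :* (s :* (u₁ :* (p :+ t :* z)) :+ (s :* u₂ :+ t :* u₂) :* z :+ t :* (s :* (u₀ :* p)))
             := s :* ((s :* u₁ :+ (t :* s) :* u₀) :* p)
                  :+ (s :* (s :* u₂ :+ (t :* s) :* u₁) :+ (t :* s) :* u₂) :* z)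
             refl s t u₀ u₁ u₂ P z ⟩
      s * ((s * u₁ + (t * s) * u₀) * P) + (s * (s * u₂ + (t * s) * u₁) + (t * s) * u₂) * z
        ≈⟨ +-cong (*-congˡ (*-congʳ (U-step m)))
                  (*-congʳ (trans (U-step (suc (suc m))) (+-congʳ (*-congˡ (U-step (suc m)))))) ⟨
      s * (u₂ * P) + U (suc (suc (suc (suc m)))) * z ∎
      where
      m = k *ℕ 2
      S = s ^ suc k
      u₀ = U m
      u₁ = U (suc m)
      u₂ = U (suc (suc m))

    cleared-odd zero = begin
      ((s * 1#) * d) * x 1
        ≈⟨ *-congˡ Y₁+ ⟨
      ((s * 1#) * d) * (Q + b * z)
        ≈⟨ solve 5 (λ s d t q w → ((s :* con 1) :* d) :* (q :+ w)
             := s :* (d :* q) :+ (s :* d :+ (t :* s) :* con 0) :* w) refl s d t Q (b * z) ⟩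
      s * (d * Q) + (s * d + (t * s) * 0#) * (b * z)
        ≈⟨ +-congˡ (*-congʳ (+-congˡ (*-congˡ U₀))) ⟨
      s * (d * Q) + (s * d + (t * s) * U 0) * (b * z)
        ≈⟨ +-congˡ (*-congʳ (U-step 0)) ⟨
      s * (d * Q) + U 2 * (b * z) ∎
    cleared-odd (suc k) = begin
      ((s * S) * d) * x (suc (suc (suc m)))
        ≈⟨ *-congˡ (x-odd-step k) ⟩
      ((s * S) * d) * (b * x (suc (suc m)) + t * x (suc m))
        -- The even term keeps the full power of s, as it needs the even case at k+1; the odd term
        -- gives up one s.
        ≈⟨ solve 7 (λ s S d b t p q → ((s :* S) :* d) :* (b :* p :+ t :* q)
             := b :* (((s :* S) :* d) :* p) :+ (t :* s) :* ((S :* d) :* q))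
             refl s S d b t (x (suc (suc m))) (x (suc m)) ⟩
      b * (((s * S) * d) * x (suc (suc m))) + (t * s) * ((S * d) * x (suc m))
        ≈⟨ +-cong (*-congˡ (cleared-even (suc k))) (*-congˡ (cleared-odd k)) ⟩
      b * (s * (u₂ * P) + u₄ * z) + (t * s) * (s * (u₁ * Q) + u₂ * (b * z))
        -- The multiple of `z` from the odd case joins `P` to form P + tz = aQ; then ba = s restores
        -- the recurrence for `U`.
        ≈⟨ solve 9 (λ s b t u₁ u₂ u₄ p q z →
                b :* (s :* (u₂ :* p) :+ u₄ :* z) :+ (t :* s) :* (s :* (u₁ :* q) :+ u₂ :* (b :* z))
             := s :* (b :* (u₂ :* (p :+ t :* z)) :+ ((t :* s) :* u₁) :* q) :+ u₄ :* (b :* z))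
             refl s b t u₁ u₂ u₄ P Q z ⟩
      s * (b * (u₂ * (P + t * z)) + ((t * s) * u₁) * Q) + u₄ * (b * z)
        ≈⟨ +-congʳ (*-congˡ (+-congʳ (*-congˡ (*-congˡ a*Y₁)))) ⟨
      s * (b * (u₂ * (a * Q)) + ((t * s) * u₁) * Q) + u₄ * (b * z)
        ≈⟨ +-congʳ (*-congˡ (solve 6 (λ a b u₂ w q u₁ →
                b :* (u₂ :* (a :* q)) :+ (w :* u₁) :* q := ((a :* b) :* u₂ :+ w :* u₁) :* q)
             refl a b u₂ (t * s) Q u₁)) ⟩
      s * ((s * u₂ + (t * s) * u₁) * Q) + u₄ * (b * z)
        ≈⟨ +-congʳ (*-congˡ (*-congʳ (U-step (suc m)))) ⟨
      s * (U (suc (suc (suc m))) * Q) + u₄ * (b * z) ∎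
      where
      m = k *ℕ 2
      S = s ^ suc k
      u₁ = U (suc m)
      u₂ = U (suc (suc m))
      u₄ = U (suc (suc (suc (suc m))))

    -- `i k` is the reciprocal of the k-th denominator. It is stated with `δ` because `U 1` is α - β
    -- only up to unit laws.
    module _ {W : ℕ → Carrier} (W₀ : W 0 ≈ x 0) (W₁ : W 1 ≈ b * x 0)
      {i : ℕ → Carrier} {δ : Carrier} (U₁ : U 1 ≈ δ) (i-inverse : ∀ k → i k * (s ^ k * δ) ≈ 1#)
      where

      private
        i-inverse′ : ∀ k → i k * (s ^ k * d) ≈ 1#
        i-inverse′ k = trans (*-congˡ (*-congˡ U₁)) (i-inverse k)

        -- Uniqueness of inverses: both sides are inverse to `s ^ k * d`.
        i-step : ∀ k → i (suc k) * s ≈ i k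
        i-step k = begin
          i (suc k) * s
            ≈⟨ trans (*-congˡ (i-inverse′ k)) (*-identityʳ _) ⟨
          (i (suc k) * s) * (i k * (s ^ k * d))
            ≈⟨ solve 5 (λ j s i e d → (j :* s) :* (i :* (e :* d)) := i :* (j :* ((s :* e) :* d)))
                 refl (i (suc k)) s (i k) (s ^ k) d ⟩
          i k * (i (suc k) * (s ^ suc k * d))
            ≈⟨ trans (*-congˡ (i-inverse′ (suc k))) (*-identityʳ _) ⟩
          i k ∎

        -- After multiplication by `i (suc k)`, the extra s on the first summand lowers its
        -- reciprocal to `i k`. Hence the different denominators of A and B.
        divide : ∀ k {y u v p w} → (s ^ suc k * d) * y ≈ s * (u * p) + v * w →
          y ≈ u * (i k * p) + v * (i (suc k) * w)
        divide k {y} {u} {v} {p} {w} cleared = begin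
          y
            ≈⟨ trans (*-congʳ (i-inverse′ (suc k))) (*-identityˡ y) ⟨
          (i (suc k) * (s ^ suc k * d)) * y
            ≈⟨ *-assoc _ _ y ⟩
          i (suc k) * ((s ^ suc k * d) * y)
            ≈⟨ *-congˡ cleared ⟩
          i (suc k) * (s * (u * p) + v * w)
            ≈⟨ solve 6 (λ j s u v p w → j :* (s :* (u :* p) :+ v :* w)
                 := u :* ((j :* s) :* p) :+ v :* (j :* w)) refl (i (suc k)) s u v p w ⟩
          u * ((i (suc k) * s) * p) + v * (i (suc k) * w)
            ≈⟨ +-congʳ (*-congˡ (*-congʳ (i-step k))) ⟩
          u * (i k * p) + v * (i (suc k) * w) ∎

        -- Keeping `k` and `e` independent of `n` lets the half and the parity be rewritten without
        -- touching `x n` and `U n`.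
        Formula : (n k e : ℕ) → Set ℓ
        Formula n k e = x n ≈ U n * (i k * Y e) + U (2 *ℕ k +ℕ 2) * (i (k +ℕ 1) * W e)

        reindex : ∀ n k e {w} → W e ≈ w →
          x n ≈ U n * (i k * Y e) + U (suc (suc (k *ℕ 2))) * (i (suc k) * w) → Formula n k e
        reindex n k e {w} W≈w eq = trans eq (+-congˡ (*-cong
          (reflexive (≡.cong U (≡.sym (2*k+2≡2+k*2 k))))
          (*-cong (reflexive (≡.cong i (ℕ.+-comm 1 k))) (sym W≈w))))

      biperiodic-binet : ∀ n → x n ≈ U n * (i ⌊ n /2⌋ * Y (ε n))
        + U (2 *ℕ ⌊ n /2⌋ +ℕ 2) * (i (⌊ n /2⌋ +ℕ 1) * W (ε n))
      biperiodic-binet n with parity n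
      ... | even k = ≡.subst₂ (Formula (k *ℕ 2)) (≡.sym (⌊k*2/2⌋≡k k)) (≡.sym (ε[k*2]≡0 k))
        (reindex (k *ℕ 2) k 0 W₀ (divide k (cleared-even k)))
      ... | odd k = ≡.subst₂ (Formula (suc (k *ℕ 2))) (≡.sym (⌊1+k*2/2⌋≡k k)) (≡.sym (ε[1+k*2]≡1 k))
        (reindex (suc (k *ℕ 2)) k 1 W₁ (divide k (cleared-odd k)))

-- Congruence and unit laws for matrix products and powers

module MatrixProperties {c ℓ} (R : CommutativeRing c ℓ) where
  open CommutativeRing R
  open import Algebra.Properties.Semiring.Sum semiring using (sum; sum-cong-≋)
  open Matrices R
  open import Relation.Binary.Reasoning.Setoid setoid

  private variable
    n : ℕ

  *ᴹ-cong : {M M′ N N′ : Matrix Carrier n} → M ≈ᴹ M′ → N ≈ᴹ N′ → M *ᴹ N ≈ᴹ M′ *ᴹ N′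
  *ᴹ-cong M≈M′ N≈N′ i j = sum-cong-≋ λ k → *-cong (M≈M′ i k) (N≈N′ k j)

  ^ᴹ-congˡ : {M M′ : Matrix Carrier n} → M ≈ᴹ M′ → ∀ m → M ^ᴹ m ≈ᴹ M′ ^ᴹ m
  ^ᴹ-congˡ M≈M′ zero    i j = refl
  ^ᴹ-congˡ {M = M} {M′} M≈M′ (suc m) =
    *ᴹ-cong {M = M} {M′} {M ^ᴹ m} {M′ ^ᴹ m} M≈M′ (^ᴹ-congˡ {M = M} {M′} M≈M′ m)

  sum-0* : (f : Vector Carrier n) → sum (λ k → 0# * f k) ≈ 0#
  sum-0* {zero}  f = refl
  sum-0* {suc n} f = trans (+-cong (zeroˡ _) (sum-0* (λ k → f (suc k)))) (+-identityˡ 0#)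

  -- Induction on the row: row 0 keeps the head and kills the tail; a later row kills the head and
  -- acts on the tail as a row of the smaller identity matrix.
  sum-1ᴹ* : (f : Vector Carrier n) (i : Fin n) → sum (λ k → 1ᴹ i k * f k) ≈ f i
  sum-1ᴹ* f zero    = trans (+-cong (*-identityˡ _) (sum-0* (λ k → f (suc k)))) (+-identityʳ _)
  sum-1ᴹ* f (suc i) = trans (+-cong (zeroˡ _) (sum-1ᴹ* (λ k → f (suc k)) i)) (+-identityˡ _)

  -- Turns columns of the identity into rows, so that the right unit law also follows from
  -- `sum-1ᴹ*`.
  1ᴹ-sym : (i j : Fin n) → 1ᴹ i j ≡ 1ᴹ j i
  1ᴹ-sym zero    zero    = ≡.refl
  1ᴹ-sym zero    (suc j) = ≡.refl
  1ᴹ-sym (suc i) zero    = ≡.refl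
  1ᴹ-sym (suc i) (suc j) = 1ᴹ-sym i j

  *ᴹ-identityˡ : (M : Matrix Carrier n) → 1ᴹ *ᴹ M ≈ᴹ M
  *ᴹ-identityˡ M i j = sum-1ᴹ* (λ k → M k j) i

  *ᴹ-identityʳ : (M : Matrix Carrier n) → M *ᴹ 1ᴹ ≈ᴹ M
  *ᴹ-identityʳ M i j = begin
    sum (λ k → M i k * 1ᴹ k j)
      ≈⟨ sum-cong-≋ (λ k → trans (*-comm _ _) (*-congʳ (reflexive (1ᴹ-sym k j)))) ⟩
    sum (λ k → 1ᴹ j k * M i k)
      ≈⟨ sum-1ᴹ* (M i) j ⟩
    M i j ∎

  -- This and the next lemma reduce the numerator of A to one factor, for odd and even index. A
  -- first power computes to a product with `1ᴹ`, hence the two unit laws.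
  ^1*^0 : (M N : Matrix Carrier n) → M ^ᴹ 1 *ᴹ N ^ᴹ 0 ≈ᴹ M
  ^1*^0 M N i j = trans (*ᴹ-identityʳ (M *ᴹ 1ᴹ) i j) (*ᴹ-identityʳ M i j)

  ^0*^1 : (M N : Matrix Carrier n) → M ^ᴹ 0 *ᴹ N ^ᴹ 1 ≈ᴹ N
  ^0*^1 M N i j = trans (*ᴹ-identityˡ (N *ᴹ 1ᴹ) i j) (*ᴹ-identityʳ N i j)

-- The embedding into the complexification respects sums and products

module EmbeddingProperties {c ℓ₁ ℓ₂} (F : HeytingField c ℓ₁ ℓ₂)
  (x#0⊎y#0⇒x²+y²#0 : SumsOfTwoSquares#0 F) where
  open HeytingField F
  open Complexification F x#0⊎y#0⇒x²+y²#0
  open RingProperties (CommutativeRing.ring (Field.commutativeRing F)) using (-0#≈0#)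

  embed-cong : ∀ {x y} → x ≈ y → embed x ≈ᶜ embed y
  embed-cong x≈y = record { re≈ = x≈y ; im≈ = refl }

  embed-+ : ∀ x y → embed (x + y) ≈ᶜ embed x +ᶜ embed y
  embed-+ x y = record { re≈ = refl ; im≈ = sym (+-identityˡ 0#) }

  embed-* : ∀ x y → embed (x * y) ≈ᶜ embed x *ᶜ embed y
  embed-* x y = record
    { re≈ = sym (trans (+-congˡ (trans (-‿cong (zeroˡ 0#)) -0#≈0#)) (+-identityʳ (x * y)))
    ; im≈ = sym (trans (+-cong (zeroʳ x) (zeroˡ y)) (+-identityʳ 0#))
    }

-- Entries of the matrices in the numerator of A

module CoefficientEntries {c ℓ} (R : CommutativeRing c ℓ) where
  open CommutativeRing R
  open RingProperties ring using (-0#≈0#)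
  open Matrices R
  open import Relation.Binary.Reasoning.Setoid setoid

  private
    x-y*0≈x : ∀ x y → x - y * 0# ≈ x
    x-y*0≈x x y = trans (+-congˡ (trans (-‿cong (zeroʳ y)) -0#≈0#)) (+-identityʳ x)

    x-y*1≈x-y : ∀ x y → x - y * 1# ≈ x - y
    x-y*1≈x-y x y = +-congˡ (-‿cong (*-identityʳ y))

  module _ (a b t a⁻¹ : Carrier) (a⁻¹*a≈1 : a⁻¹ * a ≈ 1#) where

    private
      J₀ J₁ : Matrix Carrier 2
      J₀ = ⟦ 1# , 0#
           ∣ 0# , 1# ⟧
      J₁ = ⟦ b  , t * (b * a⁻¹)
           ∣ 1# , 0# ⟧

    odd-entries : J₁ -ᴹ b • J₀ ≈ᴹ ⟦ 0# , t * (b * a⁻¹)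
                                  ∣ 1# , - b ⟧
    odd-entries zero       zero       = trans (x-y*1≈x-y b b) (-‿inverseʳ b)
    odd-entries zero       (suc zero) = x-y*0≈x (t * (b * a⁻¹)) b
    odd-entries (suc zero) zero       = x-y*0≈x 1# b
    odd-entries (suc zero) (suc zero) = trans (x-y*1≈x-y 0# b) (+-identityˡ (- b))

    even-entries : a • J₁ -ᴹ t • J₀ -ᴹ (a * b) • J₀ ≈ᴹ ⟦ - t , t * b
                                                      ∣ a   , - t - a * b ⟧
    even-entries zero zero = begin
      a * b - t * 1# - (a * b) * 1#   ≈⟨ trans (x-y*1≈x-y _ _) (+-congʳ (x-y*1≈x-y _ _)) ⟩
      a * b - t - a * b               ≈⟨ +-congʳ (+-comm (a * b) (- t)) ⟩
      - t + a * b - a * b             ≈⟨ +-assoc (- t) (a * b) (- (a * b)) ⟩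
      - t + (a * b - a * b)           ≈⟨ +-congˡ (-‿inverseʳ (a * b)) ⟩
      - t + 0#                        ≈⟨ +-identityʳ (- t) ⟩
      - t                             ∎
    -- The one entry in which the quotient b/a meets the factor a and cancels.
    even-entries zero (suc zero) = begin
      a * (t * (b * a⁻¹)) - t * 0# - (a * b) * 0#   ≈⟨ trans (x-y*0≈x _ _) (x-y*0≈x _ _) ⟩
      a * (t * (b * a⁻¹))                           ≈⟨ *-comm a _ ⟩
      t * (b * a⁻¹) * a                             ≈⟨ *-congʳ (*-assoc t b a⁻¹) ⟨
      t * b * a⁻¹ * a                               ≈⟨ *-assoc (t * b) a⁻¹ a ⟩
      t * b * (a⁻¹ * a)                             ≈⟨ *-congˡ a⁻¹*a≈1 ⟩
      t * b * 1#                                    ≈⟨ *-identityʳ (t * b) ⟩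
      t * b                                         ∎
    even-entries (suc zero) zero = trans (trans (x-y*0≈x _ _) (x-y*0≈x _ _)) (*-identityʳ a)
    even-entries (suc zero) (suc zero) = begin
      a * 0# - t * 1# - (a * b) * 1#   ≈⟨ trans (x-y*1≈x-y _ _) (+-congʳ (x-y*1≈x-y _ _)) ⟩
      a * 0# - t - a * b               ≈⟨ +-congʳ (+-congʳ (zeroʳ a)) ⟩
      0# - t - a * b                   ≈⟨ +-congʳ (+-identityˡ (- t)) ⟩
      - t - a * b                      ∎

-- The Binet formula for the bi-periodic Jacobsthal matrices

open import Defs

private
  ℝ-ring ℂ-ring : CommutativeRing _ _
  ℝ-ring = Field.commutativeRing Real.heytingField
  ℂ-ring = Field.commutativeRing ℂ-heytingField

  module R = CommutativeRing ℝ-ring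
  module C = CommutativeRing ℂ-ring

open EmbeddingProperties Real.heytingField Real.x#0⊎y#0⇒x²+y²#0
open BinetFormulas
open MatrixProperties ℝ-ring
open CoefficientEntries ℝ-ring
open import Algebra.Properties.Semiring.Exp C.semiring using (^-congˡ)

-- Here and in the next two equations both sides are constant sequences, so evaluating closed
-- rationals suffices.
two≈1+1 : two ≈ 1# + 1#
two≈1+1 = Real.pointwise⇒≈ λ _ → ≡.refl

½*two≈1 : Real.fromℚ ½ * two ≈ 1#
½*two≈1 = Real.pointwise⇒≈ λ _ → ≡.refl

eight≈two³ : Real.fromℚ (+ 8 ℚ./ 1) ≈ two * (two * two)
eight≈two³ = Real.pointwise⇒≈ λ _ → ≡.refl

module _ (a b : ℝ) (a#0 : a # 0#) (b#0 : b # 0#) where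
  open BiPeriodicJacobsthal a b a#0 b#0

  Q P : Matrix ℝ 2
  Q = J 1 -ᴹ b • J 0
  P = a • J 1 -ᴹ two • J 0 -ᴹ (a * b) • J 0

  a*Q≈P+2J₀ : ∀ i j → a * Q i j ≈ P i j + two * J 0 i j
  a*Q≈P+2J₀ i j = even-coefficient ℝ-ring a b two (J 0 i j) (J 1 i j)

  Q+bJ₀≈J₁ : ∀ i j → Q i j + b * J 0 i j ≈ J 1 i j
  Q+bJ₀≈J₁ i j = R.trans (R.+-assoc _ _ _) (R.trans (R.+-congˡ (R.-‿inverseˡ _)) (R.+-identityʳ _))

  ι-discriminant : ι discriminant
    ≈ᶜ (ι (a * b) *ᶜ ι (a * b)) +ᶜ (ι (Real.fromℚ (+ 8 ℚ./ 1)) *ᶜ ι (a * b))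
  ι-discriminant = C.trans (embed-+ _ _) (C.+-cong
    (C.trans (embed-cong a²b²) (embed-* _ _)) (embed-* _ _))
    where
    open SemiringSolver R.commutativeSemiring using (solve; con; _:*_; _:=_)
    a²b² : a ^ 2 * b ^ 2 ≈ (a * b) * (a * b)
    a²b² = solve 2 (λ a b → (a :* (a :* con 1)) :* (b :* (b :* con 1)) := (a :* b) :* (a :* b))
      R.refl a b

  module _ (√Δ : ℂ) (√Δ² : √Δ ^ᶜ 2 ≈ᶜ ι discriminant) where
    open Binet √Δ

    ιtwo≈1+1 : ι two ≈ᶜ C.1# +ᶜ C.1#
    ιtwo≈1+1 = C.trans (embed-cong two≈1+1) (embed-+ _ _)

    ι½*ιtwo≈1 : ι (Real.fromℚ ½) *ᶜ ι two ≈ᶜ C.1#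
    ι½*ιtwo≈1 = C.trans (C.sym (embed-* _ _)) (embed-cong ½*two≈1)

    ιeight≈ιtwo³ : ι (Real.fromℚ (+ 8 ℚ./ 1)) ≈ᶜ ι two *ᶜ (ι two *ᶜ ι two)
    ιeight≈ιtwo³ = C.trans (embed-cong eight≈two³) (C.trans (embed-* _ _) (C.*-congˡ (embed-* _ _)))

    √Δ*√Δ : √Δ *ᶜ √Δ ≈ᶜ (ι (a * b) *ᶜ ι (a * b)) +ᶜ (ι (Real.fromℚ (+ 8 ℚ./ 1)) *ᶜ ι (a * b))
    √Δ*√Δ = C.trans (C.*-congˡ (C.sym (C.*-identityʳ √Δ))) (C.trans √Δ² ι-discriminant)

    α² : α *ᶜ α ≈ᶜ (ι (a * b) *ᶜ α) +ᶜ (ι two *ᶜ ι (a * b))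
    α² = half-sum-root ℂ-ring ιtwo≈1+1 ι½*ιtwo≈1 ιeight≈ιtwo³ √Δ*√Δ

    β² : β *ᶜ β ≈ᶜ (ι (a * b) *ᶜ β) +ᶜ (ι two *ᶜ ι (a * b))
    β² = half-difference-root ℂ-ring ιtwo≈1+1 ι½*ιtwo≈1 ιeight≈ιtwo³ √Δ*√Δ

    U : ℕ → ℂ
    U n = α ^ᶜ n -ᶜ β ^ᶜ n

    -- The scalar formula takes s as a product of its two coefficients, so `ι (a * b)` is split.
    U-step : ∀ n → U (suc (suc n)) ≈ᶜ
      ((ι a *ᶜ ι b) *ᶜ U (suc n)) +ᶜ ((ι two *ᶜ (ι a *ᶜ ι b)) *ᶜ U n)
    U-step n = C.trans (power-difference-step ℂ-ring α² β² n)
      (C.+-cong (C.*-congʳ (embed-* a b)) (C.*-congʳ (C.*-congˡ (embed-* a b))))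

    U₁ : U 1 ≈ᶜ α -ᶜ β
    U₁ = C.+-cong (C.*-identityʳ α) (C.-‿cong (C.*-identityʳ β))

    module _ (α#β : α #ᶜ β) where
      open Coefficients α#β

      1/denominator-inverse : ∀ k →
        1/denominator k *ᶜ ((ι a *ᶜ ι b) ^ᶜ k *ᶜ (α -ᶜ β)) ≈ᶜ C.1#
      1/denominator-inverse k = C.trans
        (C.*-congˡ (C.*-congʳ (^-congˡ k (C.sym (embed-* a b)))))
        (Field.*-inverseˡ ℂ-heytingField (denominator k) (denominator#0 k))

      -- Sums and scalar multiples of matrices act entrywise, so the scalar formula applies to each
      -- entry; the matrix products in A are hidden in `Y`.
      binet : ∀ n → mapᴹ ι (J n) ≈ᶜᴹ U n •ᶜ A n +ᶜᴹ U (2 *ℕ ⌊ n /2⌋ +ℕ 2) •ᶜ B n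
      binet n i j = biperiodic-binet ℂ-ring
        {a = ι a} {b = ι b} {t = ι two} {U = U} {x = λ n → ι (J n i j)}
        {coefficient = λ e → ι (if e ≡ᵇ 0 then a else b)}
        (C.-‿inverseʳ C.1#) U-step C.refl C.refl
        -- `ε (suc (suc n))` computes to `ε n`, so the recurrence of `J` already has the required
        -- coefficient.
        (λ n → C.trans (embed-+ _ _) (C.+-cong (embed-* _ _) (embed-* _ _)))
        -- The exponents e and 1 - e select `P` for e = 0 and `Q` for e = 1.
        {Y = λ e → ι ((Q ^ᴹ e *ᴹ P ^ᴹ (1 ∸ e)) i j)}
        (C.trans (C.sym (embed-* _ _)) (C.trans (embed-cong
          (R.trans (R.*-congˡ (^1*^0 Q P i j))
            (R.trans (a*Q≈P+2J₀ i j) (R.+-congʳ (R.sym (^0*^1 Q P i j))))))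
          (C.trans (embed-+ _ _) (C.+-congˡ (embed-* _ _)))))
        (C.trans (C.+-congˡ (C.sym (embed-* _ _))) (C.trans (C.sym (embed-+ _ _))
          (embed-cong (R.trans (R.+-congʳ (^1*^0 Q P i j)) (Q+bJ₀≈J₁ i j)))))
        {W = λ e → ι ((b ^ e • J 0) i j)}
        (embed-cong (R.*-identityˡ _))
        (C.trans (embed-cong (R.*-congʳ (R.*-identityʳ b))) (embed-* _ _))
        {i = 1/denominator} {δ = α -ᶜ β} U₁ 1/denominator-inverse n

      A≈A-entries : ∀ n → A n ≈ᶜᴹ A-entries n
      A≈A-entries n i j = C.*-congˡ (embed-cong (*ᴹ-cong
        {M = Q ^ᴹ ε n} {Q′ ^ᴹ ε n} {P ^ᴹ (1 ∸ ε n)} {P′ ^ᴹ (1 ∸ ε n)}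
        (^ᴹ-congˡ {M = Q} {Q′} (odd-entries a b two a⁻¹ a⁻¹*a≈1) (ε n))
        (^ᴹ-congˡ {M = P} {P′} (even-entries a b two a⁻¹ a⁻¹*a≈1) (1 ∸ ε n)) i j))
        where
        a⁻¹ = inverse a a#0
        a⁻¹*a≈1 = Field.*-inverseˡ Real.heytingField a a#0
        Q′ P′ : Matrix ℝ 2
        Q′ = ⟦ 0# , two * (b * a⁻¹)
             ∣ 1# , - b ⟧
        P′ = ⟦ - two , two * b
             ∣ a     , - two - a * b ⟧

      B≈B-entries : ∀ n → B n ≈ᶜᴹ B-entries n
      B≈B-entries n i j = C.trans (C.*-congˡ (embed-* (b ^ ε n) (J 0 i j)))
        (C.trans (C.sym (C.*-assoc _ _ _)) (C.*-congʳ (C.*-comm _ _)))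

theorem8 : (a b : ℝ) (a#0 : a # 0#) (b#0 : b # 0#) →
    let open BiPeriodicJacobsthal a b a#0 b#0 in
    (√Δ : ℂ) → √Δ ^ᶜ 2 ≈ᶜ ι discriminant →
    let open Binet √Δ in
    (α#β : α #ᶜ β) →
    let open Coefficients α#β in
    (n : ℕ) →
    mapᴹ ι (J n) ≈ᶜᴹ (α ^ᶜ n -ᶜ β ^ᶜ n) •ᶜ A n
    +ᶜᴹ (α ^ᶜ (2 *ℕ ⌊ n /2⌋ +ℕ 2) -ᶜ β ^ᶜ (2 *ℕ ⌊ n /2⌋ +ℕ 2)) •ᶜ B n
    × A n ≈ᶜᴹ A-entries n
    × B n ≈ᶜᴹ B-entries n
theorem8 a b a#0 b#0 √Δ √Δ² α#β n =
    binet a b a#0 b#0 √Δ √Δ² α#β n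
  , A≈A-entries a b a#0 b#0 √Δ √Δ² α#β n
  , B≈B-entries a b a#0 b#0 √Δ √Δ² α#β n
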